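{- For every integer $n\geq 12$, $\mathrm{ex}_{\mathcal{P}}(n,S_{2,4})\leq \frac{17}{7}n-2$.
   Context: All graphs are finite and simple. For a graph $F$, the planar Turán number $\mathrm{ex}_{\mathcal{P}}(n,F)$ is the maximum number of edges in an $n$-vertex planar graph that contains no subgraph isomorphic to $F$. For positive integers $m,k$, the double star $S_{m,k}$ is the tree obtained from an edge $xy$ (the backbone) by joining $x$ to $m$ new vertices and $y$ to $k$ further new vertices, all these $m+k$ vertices distinct. -}

module Defs where

open import Data.Bool using (Bool; true; false; T; _∨_)
open import Data.Bool.Properties using (∨-comm; T?)
open import Data.Fin using (Fin; zero; suc; splitAt; _<_)
open import Data.Fin.Properties using (_<?_; all?)
open import Data.List using (length; filter; allFin; cartesianProduct)
open import Data.Nat using (ℕ; _+_; _*_; _≤_)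
open import Data.Product using (Σ; _×_; _,_)
open import Data.Sum using ([_,_]′)
open import Function using (const)
open import Function.Bundles using (_⇔_)
open import Function.Definitions using (Injective; Surjective)
open import Level using (0ℓ)
open import Relation.Binary.Core using (Rel)
open import Relation.Binary.Construct.Closure.ReflexiveTransitive using (Star)
open import Relation.Binary.PropositionalEquality using (_≡_; refl; subst)
open import Relation.Nullary using (¬_)
open import Relation.Nullary.Decidable using (¬?; _×-dec_)
open import Relation.Unary using (Decidable)

record Graph (n : ℕ) : Set where
  field
    adj        : Fin n → Fin n → Bool
    adj-sym    : ∀ u v → adj u v ≡ adj v u
    adj-irrefl : ∀ v → adj v v ≡ false

  _~_ : Rel (Fin n) 0ℓ
  u ~ v = T (adj u v)

  ~-sym : ∀ {u v} → u ~ v → v ~ u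
  ~-sym {u} {v} = subst T (adj-sym u v)

  Edge : Fin n × Fin n → Set
  Edge (u , v) = u < v × u ~ v

  edge? : Decidable Edge
  edge? (u , v) = (u <? v) ×-dec T? (adj u v)

  edgeCount : ℕ
  edgeCount = length (filter edge? (cartesianProduct (allFin n) (allFin n)))

  Isolated : Fin n → Set
  Isolated v = ∀ u → ¬ (v ~ u)

  isolated? : Decidable Isolated
  isolated? v = all? λ u → ¬? (T? (adj v u))

  isolatedCount : ℕ
  isolatedCount = length (filter isolated? (allFin n))

  Connected : Rel (Fin n) 0ℓ
  Connected = Star _~_

  -- An edge together with an orientation.
  record Dart : Set where
    constructor dart
    field
      {tail head} : Fin n
      tail~head   : tail ~ head

-- The graph G contains a (not necessarily induced) subgraph isomorphic to F.
Contains : ∀ {k n} → Graph k → Graph n → Set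
Contains {k} {n} F G = Σ (Fin k → Fin n) λ f →
  Injective _≡_ _≡_ f × (∀ u v → Graph._~_ F u v → Graph._~_ G (f u) (f v))

SameOrbit : {A : Set} → (A → A) → Rel A 0ℓ
SameOrbit f = Star (λ x y → f x ≡ y)

-- R is an equivalence relation with exactly k classes, witnessed by a
-- numbering of the classes.
HasClasses : {A : Set} → Rel A 0ℓ → ℕ → Set
HasClasses {A} R k = Σ (A → Fin k) λ class →
  Surjective _≡_ _≡_ class × (∀ x y → R x y ⇔ (class x ≡ class y))

-- A rotation system: for every vertex v, `next v` permutes the neighbours of v
-- in a single cycle, namely their cyclic order around v in a drawing. Values of
-- `next v` outside the neighbourhood of v are irrelevant. (On a finite set, any
-- self-map for which every point reaches every other is a cyclic permutation.)
record Rotation {n} (G : Graph n) : Set where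
  open Graph G
  field
    next   : Fin n → Fin n → Fin n
    next-~ : ∀ {v u} → v ~ u → v ~ next v u
    cyclic : ∀ {v u w} → v ~ u → v ~ w → SameOrbit (next v) u w

  -- Arriving at v from u, leave along the edge that follows vu around v. The
  -- orbits of this permutation are the boundary walks of the faces.
  faceStep : Dart → Dart
  faceStep (dart {u} {v} u~v) = dart {v} {next v u} (next-~ (~-sym u~v))

-- Planarity, combinatorially: G has a rotation system of genus 0. Every
-- connected component, cellularly embedded in its own closed orientable surface
-- of genus g ≥ 0, satisfies V - E + F = 2 - 2g; an isolated vertex has no darts
-- but one face (the sphere minus a point). Summing over components, the
-- equation below says that every g is 0, i.e. that every component, and hence
-- G, is embedded in the sphere.
record Planar {n} (G : Graph n) : Set where
  open Graph G
  field
    rotation   : Rotation G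
    faces      : ℕ
    components : ℕ
    has-faces      : HasClasses (SameOrbit (Rotation.faceStep rotation)) faces
    has-components : HasClasses Connected components
    euler : n + (faces + isolatedCount) ≡ edgeCount + 2 * components

-- ex_P(n , F) = m, i.e. m is the maximum number of edges of an n-vertex planar
-- graph without a subgraph isomorphic to F.
IsPlanarTuránNumber : ∀ {k} → ℕ → Graph k → ℕ → Set
IsPlanarTuránNumber n F m =
    (Σ (Graph n) λ G → Planar G × ¬ Contains F G × Graph.edgeCount G ≡ m)
  × (∀ (G : Graph n) → Planar G → ¬ Contains F G → Graph.edgeCount G ≤ m)

-- S_{m,k}: the backbone is {0 , 1}; of the other vertices, the first m are
-- joined to 0 and the last k to 1.
doubleStar : (m k : ℕ) → Graph (2 + (m + k))
doubleStar m k = record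
  { adj        = λ u v → arc u v ∨ arc v u
  ; adj-sym    = λ u v → ∨-comm (arc u v) (arc v u)
  ; adj-irrefl = irrefl
  }
  where
  arc : Fin (2 + (m + k)) → Fin (2 + (m + k)) → Bool
  arc zero       (suc zero)    = true
  arc zero       (suc (suc i)) = [ const true , const false ]′ (splitAt m i)
  arc (suc zero) (suc (suc i)) = [ const false , const true ]′ (splitAt m i)
  arc _          _             = false

  irrefl : ∀ v → arc v v ∨ arc v v ≡ false
  irrefl zero          = refl
  irrefl (suc zero)    = refl
  irrefl (suc (suc i)) = refl

{-# OPTIONS --safe #-}

-- Every planar S₂,₄-free graph on n vertices has e ≤ 23n/10 edges, which is stronger than the theorem for n ≥ 12.
-- By induction one may delete any vertex set meeting few edges: first vertices of degree ≤ 2, then, since freeness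
-- makes a vertex of degree ≥ 6 and its neighbours a component on 7 vertices (so with at most 15 edges), all vertices of
-- degree ≥ 6. Now let v have degree 5. Freeness leaves each neighbour of v at most one neighbour outside N[v], and
-- as N(v) spans neither K₄ nor K₂,₃ at least two neighbours of v have degree ≤ 4. Discharging from vertices of degree
-- ≤ 4 to those of degree 5 then bounds the average degree by 23/5.
--
-- Planarity enters only through e ≤ 3n − 6 and e ≤ 2n − 4 for subgraphs. These need Euler's inequality for subgraphs,
-- which the Euler equation of the whole graph implies: cutting a dart off its vertex never decreases V + F − 2C.
module Submission where

open import Defs

-- The constant 23/5 comes from the fan. If a vertex of degree 5 were only known to have two
-- neighbours of degree 4, each shared among up to four vertices of degree 5, equal shares would
-- balance at the average 14/3. That allows 28 edges at n = 12, where the theorem allows 27. In this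
-- worst case, however, the neighbourhood has a hub, and the hub limits each of the two neighbours
-- to three vertices of degree 5. The shares then balance at 5 - 2/5 = 23/5.
--
-- No rotation system of a subgraph is ever constructed. Cutting keeps all darts, so E stays
-- constant. An edge cut off at both ends becomes a component with two vertices and one face; it
-- adds 1 to both sides of V + F - 2C = E and drops out. In the same spirit, deleting vertices means
-- passing to a smaller vertex set `S` inside the fixed graph, so that planarity and freeness are
-- assumed for `G` alone.

module EdgeBound where

  open import Data.Nat.Properties using (+-*-semiring)
  open import Algebra.Properties.Semiring.Sum +-*-semiring
    using (sum; sum-cong-≗; ∑-distrib-+; ∑-comm; sum-permute; *-distribˡ-sum; *-distribʳ-sum)
  open import Data.Bool using (Bool; true; false; T; if_then_else_; not; _xor_)
  open import Data.Bool.Properties using (T?; T-irrelevant)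
  open import Data.Empty using (⊥; ⊥-elim)
  open import Data.Fin using (Fin; zero; suc; toℕ; _↑ˡ_; _↑ʳ_; combine; remQuot; punchIn; punchOut; inject≤)
  import Data.Fin as Fin
  open import Data.Fin.Induction using () renaming (<-wellFounded to Fin-<-wellFounded)
  open import Data.Fin.Permutation using (permutation)
  open import Data.Fin.Properties using (any?; all?; remQuot-combine; combine-remQuot)
  import Data.Fin.Properties as Fin
  open import Data.List using ([]; _∷_; length; filter; tabulate; map; allFin; cartesianProduct; _++_)
  open import Data.List.Membership.Propositional.Properties using (∈-allFin)
  open import Data.List.Properties using (filter-++; length-++)
  open import Data.List.Relation.Unary.All using (All; []; _∷_)
  import Data.List.Relation.Unary.All as All
  open import Data.Nat using (ℕ; zero; suc; _+_; _*_; _≤_; _<_; z≤n; s≤s; s≤s⁻¹)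
  open import Data.Nat.GeneralisedArithmetic using (fold; fold-+)
  open import Data.Nat.Properties hiding (+-*-semiring)
  open import Data.Nat.Tactic.RingSolver using (solve-∀)
  open import Data.Product using (Σ; ∃; _×_; _,_; proj₁; proj₂)
  open import Data.Sum using (_⊎_; inj₁; inj₂)
  import Data.Sum as Sum
  open import Data.Unit using (tt)
  open import Data.Vec using (Vec; lookup) renaming ([] to []ᵥ; _∷_ to _∷ᵥ_)
  open import Data.Vec.Functional using () renaming (_∷_ to _∷ᶠ_)
  open import Function using (_∘_; id)
  open import Function.Bundles using (Equivalence)
  open import Induction.WellFounded using (Acc; acc)
  open import Level using (0ℓ)
  open import Relation.Binary using (Rel; Decidable; IsEquivalence; _⇒_)
  open import Relation.Binary.Construct.Closure.Equivalence using (EqClosure)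
  import Relation.Binary.Construct.Closure.Equivalence as Eq
  open import Relation.Binary.Construct.Closure.ReflexiveTransitive using (Star; ε; _◅_; _◅◅_)
  open import Relation.Binary.Construct.Closure.Symmetric using (SymClosure; fwd; bwd)
  open import Relation.Binary.Definitions using (tri<; tri≈; tri>)
  open import Relation.Binary.PropositionalEquality
    using (_≡_; _≢_; refl; sym; trans; cong; cong₂; subst; subst₂; module ≡-Reasoning)
  open import Relation.Nullary using (¬_; Dec; yes; no; does)
  open import Relation.Nullary.Decidable
    using (_×-dec_; _⊎-dec_; ¬?; _→-dec_; map′; from-yes; ¬¬-excluded-middle; decidable-stable)

  -- Indicators, finite sums and counting

  private variable
    k m n : ℕ
    P Q R : Set

  Injective : ∀ {A B : Set} → (A → B) → Set
  Injective f = ∀ {x y} → f x ≡ f y → x ≡ y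

  𝟙 : Dec P → ℕ
  𝟙 p = if does p then 1 else 0

  𝟙-yes : (p : Dec P) → P → 𝟙 p ≡ 1
  𝟙-yes (yes _) _ = refl
  𝟙-yes (no ¬x) x = ⊥-elim (¬x x)

  𝟙-no : (p : Dec P) → ¬ P → 𝟙 p ≡ 0
  𝟙-no (yes x) ¬x = ⊥-elim (¬x x)
  𝟙-no (no _)  _  = refl

  𝟙≤1 : (p : Dec P) → 𝟙 p ≤ 1
  𝟙≤1 (yes _) = s≤s z≤n
  𝟙≤1 (no _)  = z≤n

  𝟙-mono : (p : Dec P) (q : Dec Q) → (P → Q) → 𝟙 p ≤ 𝟙 q
  𝟙-mono (no _)  q f = z≤n
  𝟙-mono (yes x) q f = ≤-reflexive (sym (𝟙-yes q (f x)))

  𝟙-cong : (p : Dec P) (q : Dec Q) → (P → Q) → (Q → P) → 𝟙 p ≡ 𝟙 q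
  𝟙-cong p q f g = ≤-antisym (𝟙-mono p q f) (𝟙-mono q p g)

  𝟙-cover : (p : Dec P) (q : Dec Q) (r : Dec R) → (P → Q ⊎ R) → 𝟙 p ≤ 𝟙 q + 𝟙 r
  𝟙-cover (no _)  q r f = z≤n
  𝟙-cover (yes x) q r f with f x
  ... | inj₁ y = ≤-trans (≤-reflexive (sym (𝟙-yes q y))) (m≤m+n _ _)
  ... | inj₂ z = ≤-trans (≤-reflexive (sym (𝟙-yes r z))) (m≤n+m _ (𝟙 q))

  𝟙-disjoint : (p : Dec P) (q : Dec Q) (r : Dec R) →
               (P → R) → (Q → R) → (P → Q → ⊥) → 𝟙 p + 𝟙 q ≤ 𝟙 r
  𝟙-disjoint (yes x) (yes y) r f g h = ⊥-elim (h x y)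
  𝟙-disjoint (yes x) (no _)  r f g h = ≤-reflexive (sym (𝟙-yes r (f x)))
  𝟙-disjoint (no _)  q       r f g h = 𝟙-mono q r g

  𝟙-× : (p : Dec P) (q : Dec Q) → 𝟙 (p ×-dec q) ≡ 𝟙 p * 𝟙 q
  𝟙-× (yes _) q = sym (+-identityʳ (𝟙 q))
  𝟙-× (no _)  q = refl

  sum-mono : {f g : Fin n → ℕ} → (∀ i → f i ≤ g i) → sum f ≤ sum g
  sum-mono {zero}  h = z≤n
  sum-mono {suc n} h = +-mono-≤ (h zero) (sum-mono (h ∘ suc))

  sum-mono-< : {f g : Fin n → ℕ} → (∀ i → f i ≤ g i) → ∀ i → f i < g i → sum f < sum g
  sum-mono-< h zero    l = +-mono-≤ l (sum-mono (h ∘ suc))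
  sum-mono-< h (suc i) l = +-mono-≤-< (h zero) (sum-mono-< (h ∘ suc) i l)

  term≤sum : (f : Fin n → ℕ) → ∀ i → f i ≤ sum f
  term≤sum f zero    = m≤m+n _ _
  term≤sum f (suc i) = ≤-trans (term≤sum (f ∘ suc) i) (m≤n+m _ (f zero))

  sum-const : ∀ n c → sum {n} (λ _ → c) ≡ n * c
  sum-const zero    c = refl
  sum-const (suc n) c = cong (c +_) (sum-const n c)

  sum-zero : {f : Fin n → ℕ} → (∀ i → f i ≡ 0) → sum f ≡ 0
  sum-zero {n} h = trans (sum-cong-≗ h) (trans (sum-const n 0) (*-zeroʳ n))

  sum-++ : ∀ m (f : Fin (m + n) → ℕ) → sum f ≡ sum (λ i → f (i ↑ˡ n)) + sum (λ j → f (m ↑ʳ j))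
  sum-++ zero    f = refl
  sum-++ (suc m) f = trans (cong (f zero +_) (sum-++ m (f ∘ suc))) (sym (+-assoc (f zero) _ _))

  sum-combine : ∀ m {n} (f : Fin (m * n) → ℕ) → sum f ≡ sum λ i → sum λ j → f (combine {m} i j)
  sum-combine zero    f = refl
  sum-combine (suc m) {n} f = trans (sum-++ n f) (cong (sum (λ i → f (i ↑ˡ (m * n))) +_) (sum-combine m (λ i → f (n ↑ʳ i))))

  count : {P : Fin n → Set} → (∀ i → Dec (P i)) → ℕ
  count P? = sum λ i → 𝟙 (P? i)

  module _ {P : Fin n → Set} (P? : ∀ i → Dec (P i)) where

    count≤ : count P? ≤ n
    count≤ = ≤-trans (sum-mono (λ i → 𝟙≤1 (P? i))) (≤-reflexive (trans (sum-const n 1) (*-identityʳ n)))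

    count-all : (∀ i → P i) → count P? ≡ n
    count-all h = trans (sum-cong-≗ (λ i → 𝟙-yes (P? i) (h i))) (trans (sum-const n 1) (*-identityʳ n))

    count-mono : {Q : Fin n → Set} (Q? : ∀ i → Dec (Q i)) → (∀ {i} → P i → Q i) → count P? ≤ count Q?
    count-mono Q? h = sum-mono (λ i → 𝟙-mono (P? i) (Q? i) h)

    count-∃ : ∀ {i} → P i → 1 ≤ count P?
    count-∃ {i} p = ≤-trans (≤-reflexive (sym (𝟙-yes (P? i) p))) (term≤sum _ i)

    count≡0 : (∀ i → ¬ P i) → count P? ≡ 0
    count≡0 h = sum-zero (λ i → 𝟙-no (P? i) (h i))

  count-≟ : (i : Fin n) → count (i Fin.≟_) ≡ 1
  count-≟ {suc n} zero    = cong suc (count≡0 {n = n} (λ j → zero Fin.≟ suc j) λ _ ())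
  count-≟ {suc n} (suc i) =
    trans (sum-cong-≗ λ j → 𝟙-cong (suc i Fin.≟ suc j) (i Fin.≟ j) Fin.suc-injective (cong suc)) (count-≟ i)

  count-unique : {P : Fin n → Set} (P? : ∀ i → Dec (P i)) → (∀ {i j} → P i → P j → i ≡ j) → count P? ≤ 1
  count-unique P? h with any? P?
  ... | yes (i , p) = ≤-trans (count-mono P? (i Fin.≟_) (h p)) (≤-reflexive (count-≟ i))
  ... | no ¬∃ = ≤-trans (≤-reflexive (count≡0 P? λ i p → ¬∃ (i , p))) z≤n

  -- Double counting of the pairs (i , j) related by R.
  count-inject : {P : Fin m → Set} {Q : Fin n → Set} {R : Fin m → Fin n → Set}
    (P? : ∀ i → Dec (P i)) (Q? : ∀ j → Dec (Q j)) (R? : ∀ i j → Dec (R i j)) →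
    (∀ {i} → P i → ∃ λ j → Q j × R i j) →
    (∀ {i i′ j} → P i → P i′ → Q j → R i j → R i′ j → i ≡ i′) →
    count P? ≤ count Q?
  count-inject {P = P} {Q} {R} P? Q? R? total unique = begin
    count P?                          ≤⟨ sum-mono outgoing ⟩
    (sum λ i → sum λ j → 𝟙 (S? i j))  ≡⟨ ∑-comm (λ i j → 𝟙 (S? i j)) ⟩
    (sum λ j → sum λ i → 𝟙 (S? i j))  ≤⟨ sum-mono incoming ⟩
    count Q?                          ∎
    where
    open ≤-Reasoning
    S? : ∀ i j → Dec (P i × Q j × R i j)
    S? i j = P? i ×-dec (Q? j ×-dec R? i j)
    outgoing : ∀ i → 𝟙 (P? i) ≤ count (S? i)
    outgoing i with P? i in eq
    ... | no _  = z≤n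
    ... | yes p with total p
    ...   | j , q , r = count-∃ (λ j → yes p ×-dec (Q? j ×-dec R? i j)) {j} (p , q , r)
    incoming : ∀ j → count (λ i → S? i j) ≤ 𝟙 (Q? j)
    incoming j with Q? j
    ... | yes q = count-unique (λ i → P? i ×-dec (yes q ×-dec R? i j)) λ { (p , q , r) (p′ , _ , r′) → unique p p′ q r r′ }
    ... | no ¬q = ≤-reflexive (count≡0 (λ i → P? i ×-dec (no ¬q ×-dec R? i j)) λ { i (_ , q , _) → ¬q q })

  enumerate : {P : Fin n → Set} (P? : ∀ i → Dec (P i)) → ∃ λ (g : Fin (count P?) → Fin n) →
    Injective g × (∀ i → P (g i)) × (∀ {x} → P x → ∃ λ i → g i ≡ x)
  enumerate {zero}  P? = (λ ()) , (λ { {()} }) , (λ ()) , λ { {()} }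
  enumerate {suc n} {P} P? with P? zero | enumerate {P = P ∘ suc} (P? ∘ suc)
  ... | no ¬p | g , inj , sat , sur = suc ∘ g , inj ∘ Fin.suc-injective , sat , onto
    where
    onto : ∀ {x} → P x → ∃ λ i → suc (g i) ≡ x
    onto {zero}  p = ⊥-elim (¬p p)
    onto {suc x} p with sur p
    ... | i , refl = i , refl
  ... | yes p | g , inj , sat , sur = h , h-inj , h-sat , onto
    where
    h : Fin (suc _) → Fin (suc n)
    h zero    = zero
    h (suc i) = suc (g i)
    h-inj : ∀ {i j} → h i ≡ h j → i ≡ j
    h-inj {zero}  {zero}  _ = refl
    h-inj {zero}  {suc j} ()
    h-inj {suc i} {zero}  ()
    h-inj {suc i} {suc j} e = cong suc (inj (Fin.suc-injective e))
    h-sat : ∀ i → P (h i)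
    h-sat zero    = p
    h-sat (suc i) = sat i
    onto : ∀ {x} → P x → ∃ λ i → h i ≡ x
    onto {zero}  p = zero , refl
    onto {suc x} p with sur p
    ... | i , refl = suc i , refl

  -- Turns a sum over a vertex set into a sum over the indices of its enumeration. Neighbourhoods of
  -- 5 vertices and components of 7 vertices are summed in this way.
  sum-image : (g : Fin m → Fin n) (F : Fin n → ℕ) {P : Fin n → Set} (P? : ∀ i → Dec (P i)) →
    Injective g → (∀ i → P (g i)) → (∀ {x} → P x → ∃ λ i → g i ≡ x) →
    (sum λ x → 𝟙 (P? x) * F x) ≡ sum (F ∘ g)
  sum-image g F P? inj sat sur = begin
    (sum λ x → 𝟙 (P? x) * F x)                  ≡⟨ sum-cong-≗ (λ x → cong (_* F x) (fibre x)) ⟩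
    (sum λ x → (sum λ i → 𝟙 (g i Fin.≟ x)) * F x) ≡⟨ sum-cong-≗ (λ x → *-distribʳ-sum (F x) (λ i → 𝟙 (g i Fin.≟ x))) ⟩
    (sum λ x → sum λ i → 𝟙 (g i Fin.≟ x) * F x)  ≡⟨ ∑-comm (λ x i → 𝟙 (g i Fin.≟ x) * F x) ⟩
    (sum λ i → sum λ x → 𝟙 (g i Fin.≟ x) * F x)  ≡⟨ sum-cong-≗ (λ i → sum-cong-≗ (point i)) ⟩
    (sum λ i → sum λ x → 𝟙 (g i Fin.≟ x) * F (g i)) ≡⟨ sum-cong-≗ (λ i → sym (*-distribʳ-sum (F (g i)) (λ x → 𝟙 (g i Fin.≟ x)))) ⟩
    (sum λ i → count (g i Fin.≟_) * F (g i))     ≡⟨ sum-cong-≗ (λ i → trans (cong (_* F (g i)) (count-≟ (g i))) (*-identityˡ _)) ⟩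
    sum (F ∘ g)                                 ∎
    where
    open ≡-Reasoning
    fibre : ∀ x → 𝟙 (P? x) ≡ count (λ i → g i Fin.≟ x)
    fibre x with P? x
    ... | yes p with sur p
    ...   | i , gi≡x = ≤-antisym (count-∃ (λ i → g i Fin.≟ x) gi≡x)
                                 (count-unique (λ i → g i Fin.≟ x) λ e e′ → inj (trans e (sym e′)))
    fibre x | no ¬p = sym (count≡0 (λ i → g i Fin.≟ x) λ { i refl → ¬p (sat i) })
    point : ∀ i x → 𝟙 (g i Fin.≟ x) * F x ≡ 𝟙 (g i Fin.≟ x) * F (g i)
    point i x with g i Fin.≟ x
    ... | yes refl = refl
    ... | no _     = refl

  count-cover : ∀ {n} {P Q R : Fin n → Set} (P? : ∀ i → Dec (P i)) (Q? : ∀ i → Dec (Q i)) (R? : ∀ i → Dec (R i)) →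
    (∀ {i} → P i → Q i ⊎ R i) → count P? ≤ count Q? + count R?
  count-cover P? Q? R? h = ≤-trans (sum-mono λ i → 𝟙-cover (P? i) (Q? i) (R? i) h)
    (≤-reflexive (∑-distrib-+ (λ i → 𝟙 (Q? i)) (λ i → 𝟙 (R? i))))

  count-disjoint : ∀ {n} {P Q R : Fin n → Set} (P? : ∀ i → Dec (P i)) (Q? : ∀ i → Dec (Q i)) (R? : ∀ i → Dec (R i)) →
    (∀ {i} → P i → R i) → (∀ {i} → Q i → R i) → (∀ {i} → P i → Q i → ⊥) → count P? + count Q? ≤ count R?
  count-disjoint P? Q? R? f g h = ≤-trans (≤-reflexive (sym (∑-distrib-+ (λ i → 𝟙 (P? i)) (λ i → 𝟙 (Q? i)))))
    (sum-mono λ i → 𝟙-disjoint (P? i) (Q? i) (R? i) f g h)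

  count-point : ∀ {n} (y : Fin n) {Q : Set} (q : Dec Q) → count (λ z → (y Fin.≟ z) ×-dec q) ≤ 𝟙 q
  count-point y (yes q) = count-unique (λ z → (y Fin.≟ z) ×-dec yes q) λ { (refl , _) (refl , _) → refl }
  count-point y (no ¬q) = ≤-reflexive (count≡0 (λ z → (y Fin.≟ z) ×-dec no ¬q) λ _ → ¬q ∘ proj₂)

  enumerate-as : ∀ {n k} {P : Fin n → Set} (P? : ∀ i → Dec (P i)) → count P? ≡ k → ∃ λ (g : Fin k → Fin n) →
    Injective g × (∀ i → P (g i)) × (∀ {x} → P x → ∃ λ i → g i ≡ x)
  enumerate-as P? refl = enumerate P?

  third : ∀ {n} {P : Fin n → Set} (P? : ∀ i → Dec (P i)) → 3 ≤ count P? → ∀ a b → ∃ λ c → P c × c ≢ a × c ≢ b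
  third P? 3≤ a b with any? (λ c → P? c ×-dec (¬? (c Fin.≟ a) ×-dec ¬? (c Fin.≟ b)))
  ... | yes found = found
  ... | no none = ⊥-elim (<⇒≱ (s≤s (≤-trans (count-cover P? (a Fin.≟_) (b Fin.≟_) split)
      (≤-reflexive (cong₂ _+_ (count-≟ a) (count-≟ b))))) 3≤)
    where
    split : ∀ {c} → _ → a ≡ c ⊎ b ≡ c
    split {c} p with a Fin.≟ c | b Fin.≟ c
    ... | yes e | _     = inj₁ e
    ... | no _  | yes e = inj₂ e
    ... | no a≢ | no b≢ = ⊥-elim (none (c , p , a≢ ∘ sym , b≢ ∘ sym))

  -- Counting equivalence classes

  ¬¬-∀ : ∀ {n} {P : Fin n → Set} → (∀ i → ¬ ¬ P i) → ¬ ¬ (∀ i → P i)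
  ¬¬-∀ {zero}  h k = k λ ()
  ¬¬-∀ {suc n} h k = h zero λ p → ¬¬-∀ (h ∘ suc) λ ps → k λ { zero → p ; (suc i) → ps i }

  -- Orbits and components are decided only up to ¬ ¬, which suffices since the bounds drawn from them are decidable.
  ¬¬-decidable : ∀ {n} (R : Rel (Fin n) 0ℓ) → ¬ ¬ Decidable R
  ¬¬-decidable R = ¬¬-∀ λ x → ¬¬-∀ λ y → ¬¬-excluded-middle

  -- The least equivalence containing R and (a , b), for an equivalence R.
  Join : ∀ {A : Set} → Rel A 0ℓ → A → A → Rel A 0ℓ
  Join R a b x y = R x y ⊎ (R x a × R b y ⊎ R x b × R a y)

  join-isEquivalence : ∀ {A : Set} {R : Rel A 0ℓ} {a b} → IsEquivalence R → IsEquivalence (Join R a b)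
  join-isEquivalence {R = R} {a} {b} R-equiv = record
    { refl = inj₁ R.refl
    ; sym = λ { (inj₁ r) → inj₁ (R.sym r)
              ; (inj₂ (inj₁ (r , s))) → inj₂ (inj₂ (R.sym s , R.sym r))
              ; (inj₂ (inj₂ (r , s))) → inj₂ (inj₁ (R.sym s , R.sym r)) }
    ; trans = join-trans
    }
    where
    module R = IsEquivalence R-equiv
    join-trans : ∀ {x y z} → Join R a b x y → Join R a b y z → Join R a b x z
    join-trans (inj₁ r)              (inj₁ s)              = inj₁ (R.trans r s)
    join-trans (inj₁ r)              (inj₂ (inj₁ (s , t))) = inj₂ (inj₁ (R.trans r s , t))
    join-trans (inj₁ r)              (inj₂ (inj₂ (s , t))) = inj₂ (inj₂ (R.trans r s , t))
    join-trans (inj₂ (inj₁ (r , s))) (inj₁ t)              = inj₂ (inj₁ (r , R.trans s t))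
    join-trans (inj₂ (inj₂ (r , s))) (inj₁ t)              = inj₂ (inj₂ (r , R.trans s t))
    join-trans (inj₂ (inj₁ (r , s))) (inj₂ (inj₁ (t , u))) = inj₂ (inj₁ (r , u))
    join-trans (inj₂ (inj₁ (r , s))) (inj₂ (inj₂ (t , u))) = inj₁ (R.trans r u)
    join-trans (inj₂ (inj₂ (r , s))) (inj₂ (inj₁ (t , u))) = inj₁ (R.trans r u)
    join-trans (inj₂ (inj₂ (r , s))) (inj₂ (inj₂ (t , u))) = inj₂ (inj₂ (r , u))

  -- Classes are counted through their least elements.
  Least : ∀ {N} → Rel (Fin N) 0ℓ → Fin N → Set
  Least R x = ∀ y → R y x → x Fin.≤ y

  least? : ∀ {N} {R : Rel (Fin N) 0ℓ} → Decidable R → ∀ x → Dec (Least R x)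
  least? R? x = all? λ y → R? y x →-dec x Fin.≤? y

  module _ {N} {R : Rel (Fin N) 0ℓ} (R-equiv : IsEquivalence R) where
    open IsEquivalence R-equiv renaming (refl to R-refl; sym to R-sym; trans to R-trans)

    least-unique : ∀ {x y} → Least R x → Least R y → R x y → x ≡ y
    least-unique lx ly r = Fin.≤-antisym (lx _ (R-sym r)) (ly _ r)

    least-exists : Decidable R → ∀ x → ∃ λ m → R m x × Least R m
    least-exists R? x = go x (Fin-<-wellFounded x)
      where
      go : ∀ x → Acc Fin._<_ x → ∃ λ m → R m x × Least R m
      go x (acc rec) with any? (λ y → R? y x ×-dec y Fin.<? x)
      ... | no ¬∃ = x , R-refl , λ y r → ≮⇒≥ λ y<x → ¬∃ (y , r , y<x)
      ... | yes (y , r , y<x) with go y (rec y<x)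
      ...   | m , r′ , lm = m , R-trans r′ r , lm

  -- `A` singles out the genuine darts; the other points of `Fin N` are fillers whose classes must
  -- not be counted.
  module Classes {N} (A : Fin N → Bool) where

    least∈? : {R : Rel (Fin N) 0ℓ} → Decidable R → ∀ x → Dec (T (A x) × Least R x)
    least∈? R? x = T? (A x) ×-dec least? R? x

    classes : {R : Rel (Fin N) 0ℓ} → Decidable R → ℕ
    classes R? = count (least∈? R?)

    module _ {R R′ : Rel (Fin N) 0ℓ} (R? : Decidable R) (R′? : Decidable R′) where

      classes-refine : R′ ⇒ R → classes R? ≤ classes R′?
      classes-refine R′⇒R = count-mono (least∈? R?) (least∈? R′?) λ { (a , l) → a , λ y r → l y (R′⇒R r) }

      -- The `R′`-least elements of the classes of `a` and `b` are distinct but `R`-related, so at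
      -- least one of them is not `R`-least. That one is counted for `R′` only.
      classes-refine-< : IsEquivalence R → IsEquivalence R′ → R′ ⇒ R → (R′ ⇒ λ x y → A x ≡ A y) →
        ∀ {a b} → T (A a) → T (A b) → R a b → ¬ R′ a b → classes R? < classes R′?
      classes-refine-< R-equiv R′-equiv R′⇒R R′-A {a} {b} Aa Ab rab ¬r′ab
        with least-exists R′-equiv R′? a | least-exists R′-equiv R′? b
      ... | x , rx , lx | y , ry , ly = strict
        where
        module R = IsEquivalence R-equiv
        module R′ = IsEquivalence R′-equiv
        rxy : R x y
        rxy = R.trans (R′⇒R rx) (R.trans rab (R.sym (R′⇒R ry)))
        x≢y : x ≢ y
        x≢y refl = ¬r′ab (R′.trans (R′.sym rx) ry)
        gain : ∀ {z} → T (A z) → Least R′ z → ¬ Least R z → classes R? < classes R′?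
        gain {z} Az lz ¬lz = sum-mono-< (λ i → 𝟙-mono (least∈? R? i) (least∈? R′? i) λ { (a , l) → a , λ y r → l y (R′⇒R r) }) z
          (≤-reflexive (trans (cong suc (𝟙-no (least∈? R? z) (¬lz ∘ proj₂)))
                              (sym (𝟙-yes (least∈? R′? z) (Az , lz)))))
        strict : classes R? < classes R′?
        strict with least? R? x | least? R? y
        ... | yes l | yes l′ = ⊥-elim (x≢y (least-unique R-equiv l l′ rxy))
        ... | no ¬l | _      = gain (subst T (sym (R′-A rx)) Aa) lx ¬l
        ... | yes _ | no ¬l  = gain (subst T (sym (R′-A ry)) Ab) ly ¬l

      -- Joining two classes loses at most one least element, the larger of their two.
      classes-join : IsEquivalence R → ∀ {a b} → (R′ ⇒ Join R a b) → classes R? ≤ suc (classes R′?)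
      classes-join R-equiv {a} {b} R′⇒ = begin
        classes R?                                       ≤⟨ sum-mono (λ x → 𝟙-cover (least∈? R? x) (least∈? R′? x) (lost? x) (split x)) ⟩
        (sum λ x → 𝟙 (least∈? R′? x) + 𝟙 (lost? x))  ≡⟨ ∑-distrib-+ (λ x → 𝟙 (least∈? R′? x)) (λ x → 𝟙 (lost? x)) ⟩
        classes R′? + count lost?                        ≤⟨ +-monoʳ-≤ (classes R′?) (count-unique lost? lost-unique) ⟩
        classes R′? + 1                                  ≡⟨ +-comm (classes R′?) 1 ⟩
        suc (classes R′?)                                ∎
        where
        open ≤-Reasoning
        module R = IsEquivalence R-equiv
        Lost : Fin N → Set
        Lost x = Least R x × ∃ λ y → R′ y x × y Fin.< x
        lost? : ∀ x → Dec (Lost x)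
        lost? x = least? R? x ×-dec any? (λ y → R′? y x ×-dec y Fin.<? x)
        split : ∀ x → T (A x) × Least R x → (T (A x) × Least R′ x) ⊎ Lost x
        split x (Ax , l) with any? (λ y → R′? y x ×-dec y Fin.<? x)
        ... | yes ∃y = inj₂ (l , ∃y)
        ... | no ¬∃ = inj₁ (Ax , λ y r → ≮⇒≥ λ y<x → ¬∃ (y , r , y<x))
        lost-unique : ∀ {x x′} → Lost x → Lost x′ → x ≡ x′
        lost-unique (l , y , r , y<x) (l′ , y′ , r′ , y′<x′) with R′⇒ r | R′⇒ r′
        ... | inj₁ s | _ = ⊥-elim (<⇒≱ y<x (l _ s))
        ... | inj₂ _ | inj₁ s = ⊥-elim (<⇒≱ y′<x′ (l′ _ s))
        ... | inj₂ (inj₁ (_ , s)) | inj₂ (inj₁ (_ , s′)) = least-unique R-equiv l l′ (R.trans (R.sym s) s′)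
        ... | inj₂ (inj₂ (_ , s)) | inj₂ (inj₂ (_ , s′)) = least-unique R-equiv l l′ (R.trans (R.sym s) s′)
        -- Losing least elements in opposite directions is circular: `y′` is in the class of `x` and
        -- `y` in that of `x′`, whence y < x ≤ y′ < x′ ≤ y.
        ... | inj₂ (inj₁ (s , t)) | inj₂ (inj₂ (s′ , t′)) =
          ⊥-elim (<-irrefl refl (<-≤-trans y<x (≤-trans (l _ (R.trans s′ t)) (≤-trans (<⇒≤ y′<x′) (l′ _ (R.trans s t′))))))
        ... | inj₂ (inj₂ (s , t)) | inj₂ (inj₁ (s′ , t′)) =
          ⊥-elim (<-irrefl refl (<-≤-trans y<x (≤-trans (l _ (R.trans s′ t)) (≤-trans (<⇒≤ y′<x′) (l′ _ (R.trans s t′))))))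

  -- Orbits of injective self-maps, and cutting a point out of its orbit

  Orbit : ∀ {A : Set} → (A → A) → Rel A 0ℓ
  Orbit f = EqClosure λ x y → f x ≡ y

  orbit-step : ∀ {A : Set} {f : A → A} {x} → Orbit f x (f x)
  orbit-step = Eq.return refl

  orbit-invariant : ∀ {A B : Set} {f : A → A} (h : A → B) → (∀ x → h (f x) ≡ h x) → Orbit f ⇒ λ x y → h x ≡ h y
  orbit-invariant h h-f = Eq.fold (record { refl = refl ; sym = sym ; trans = trans }) λ { {x} refl → sym (h-f x) }

  fixed-isolated : ∀ {A : Set} {f : A → A} {d} → Injective f → f d ≡ d → ∀ {x y} → Orbit f x y → x ≡ d → y ≡ d
  fixed-isolated f-inj fd ε x≡d = x≡d
  fixed-isolated {f = f} {d} f-inj fd (_◅_ {j = z} s r) refl = fixed-isolated f-inj fd r (step s)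
    where
    step : ∀ {z} → SymClosure (λ x y → f x ≡ y) d z → z ≡ d
    step (fwd e) = trans (sym e) fd
    step (bwd e) = f-inj (trans e (sym fd))

  fold-shift : ∀ {A : Set} (f : A → A) x k → fold (f x) f k ≡ f (fold x f k)
  fold-shift f x zero    = refl
  fold-shift f x (suc k) = cong f (fold-shift f x k)

  fold-cancel : ∀ {A : Set} {f : A → A} → Injective f → ∀ {x} i {k} → fold x f i ≡ fold x f (i + k) → x ≡ fold x f k
  fold-cancel f-inj zero    e = e
  fold-cancel f-inj (suc i) e = fold-cancel f-inj i (f-inj e)

  -- Two of the first N + 1 iterates coincide by the pigeonhole principle, and injectivity cancels
  -- their common beginning. Starting at `f x` makes `k` one less than a period, so the `k`-th
  -- iterate also serves as an inverse of `f`.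
  orbit-returns : ∀ {N} {f : Fin N → Fin N} → Injective f → ∀ x → ∃ λ k → fold (f x) f k ≡ x
  orbit-returns {N} {f} f-inj x with Fin.pigeonhole (n<1+n N) (λ i → fold x f (toℕ i))
  ... | i , j , i<j , e with m≤n⇒∃[o]m+o≡n i<j
  ...   | k , eq = k , trans (fold-shift f x k)
    (sym (fold-cancel f-inj (toℕ i) (trans e (cong (fold x f) (sym (trans (+-suc (toℕ i) k) eq))))))

  forward-path : ∀ {A : Set} (f : A → A) x k → Star (λ x y → f x ≡ y) x (fold x f k)
  forward-path f x zero    = ε
  forward-path f x (suc k) = forward-path f x k ◅◅ (refl ◅ ε)

  -- On a finite set the backward steps that `Orbit` admits can be replaced by forward ones. This
  -- allows a face to be walked in one direction until it closes.
  injective-returns : ∀ {N} {f : Fin N → Fin N} → Injective f → ∀ x → Star (λ x y → f x ≡ y) (f x) x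
  injective-returns {f = f} f-inj x with orbit-returns f-inj x
  ... | k , e = subst (Star _ (f x)) e (forward-path f (f x) k)

  -- The dart d is cut off from its vertex: it becomes a fixed point, and its predecessor is sent to its successor.
  module Unhook {N} (σ : Fin N → Fin N) (d : Fin N) where

    unhook : Fin N → Fin N
    unhook x with x Fin.≟ d | σ x Fin.≟ d
    ... | yes _ | _     = d
    ... | no _  | yes _ = σ d
    ... | no _  | no _  = σ x

    -- Each constructor keeps the value of `unhook x` together with the test results that produce
    -- it.
    data View (x : Fin N) : Set where
      cut      : x ≡ d → unhook x ≡ d → View x
      bypass   : x ≢ d → σ x ≡ d → unhook x ≡ σ d → View x
      ordinary : x ≢ d → σ x ≢ d → unhook x ≡ σ x → View x

    view : ∀ x → View x
    view x with x Fin.≟ d in p | σ x Fin.≟ d in q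
    ... | yes x≡d | _      = cut x≡d (value p q)
      where
      value : ∀ {a b} → (x Fin.≟ d) ≡ yes a → (σ x Fin.≟ d) ≡ b → unhook x ≡ d
      value p q rewrite p | q = refl
    ... | no x≢d  | yes e  = bypass x≢d e value
      where
      value : unhook x ≡ σ d
      value rewrite p | q = refl
    ... | no x≢d  | no ¬e  = ordinary x≢d ¬e value
      where
      value : unhook x ≡ σ x
      value rewrite p | q = refl

    unhook-self : unhook d ≡ d
    unhook-self with view d
    ... | cut _ e          = e
    ... | bypass d≢d _ _   = ⊥-elim (d≢d refl)
    ... | ordinary d≢d _ _ = ⊥-elim (d≢d refl)

    module _ (σ-inj : Injective σ) where

      unhook-injective : Injective unhook
      unhook-injective {x} {y} e with view x | view y
      ... | cut refl _ | cut refl _ = refl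
      ... | cut refl p | bypass y≢d q r = ⊥-elim (y≢d (σ-inj (trans q (trans (sym p) (trans e r)))))
      ... | cut refl p | ordinary y≢d q r = ⊥-elim (q (trans (sym r) (trans (sym e) p)))
      ... | bypass x≢d p q | cut refl r = ⊥-elim (x≢d (σ-inj (trans p (trans (sym r) (trans (sym e) q)))))
      ... | bypass _ p _ | bypass _ q _ = σ-inj (trans p (sym q))
      ... | bypass _ _ p | ordinary y≢d _ q = ⊥-elim (y≢d (σ-inj (trans (sym q) (trans (sym e) p))))
      ... | ordinary x≢d p q | cut refl r = ⊥-elim (p (trans (sym q) (trans e r)))
      ... | ordinary x≢d _ p | bypass _ _ q = ⊥-elim (x≢d (σ-inj (trans (sym p) (trans e q))))
      ... | ordinary _ _ p | ordinary _ _ q = σ-inj (trans (sym p) (trans e q))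

    unhook-⊆ : ∀ x → Orbit σ x (unhook x)
    unhook-⊆ x with view x
    ... | cut refl e       = subst (Orbit σ x) (sym e) ε
    ... | bypass _ e e′    = subst (Orbit σ x) (sym (trans e′ (cong σ (sym e)))) (orbit-step ◅◅ orbit-step)
    ... | ordinary _ _ e   = subst (Orbit σ x) (sym e) orbit-step

  -- Euler's formula under vertex splitting

  sum-injective : ∀ {n} {f : Fin n → Fin n} → Injective f → ∀ (F : Fin n → ℕ) → sum (F ∘ f) ≡ sum F
  sum-injective {f = f} f-inj F =
    sym (sum-permute F (permutation f f⁻¹ f-f⁻¹ (λ x → f-inj (f-f⁻¹ (f x)))))
    where
    f⁻¹ : Fin _ → Fin _
    f⁻¹ x = fold x f (proj₁ (orbit-returns f-inj x))
    f-f⁻¹ : ∀ x → f (f⁻¹ x) ≡ x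
    f-f⁻¹ x = trans (sym (fold-shift f x (proj₁ (orbit-returns f-inj x)))) (proj₂ (orbit-returns f-inj x))

  join-collapse : ∀ {A : Set} {R : Rel A 0ℓ} {a b} → IsEquivalence R → R a b → Join R a b ⇒ R
  join-collapse R-equiv rab (inj₁ r) = r
  join-collapse R-equiv rab (inj₂ (inj₁ (r , s))) = IsEquivalence.trans R-equiv r (IsEquivalence.trans R-equiv rab s)
  join-collapse R-equiv rab (inj₂ (inj₂ (r , s))) =
    IsEquivalence.trans R-equiv r (IsEquivalence.trans R-equiv (IsEquivalence.sym R-equiv rab) s)

  -- A combinatorial map: σ turns around vertices, α reverses darts, σ ∘ α follows faces.
  module Map {N} (A : Fin N → Bool) (α : Fin N → Fin N) (α-A : ∀ x → A (α x) ≡ A x)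
             (α-involutive : ∀ x → α (α x) ≡ x) (edges : ℕ) where
    open Classes A

    α-injective : Injective α
    α-injective {x} {y} e = trans (sym (α-involutive x)) (trans (cong α e) (α-involutive y))

    Face Component : (Fin N → Fin N) → Rel (Fin N) 0ℓ
    Face σ = Orbit (σ ∘ α)
    Component σ = EqClosure λ x y → σ x ≡ y ⊎ α x ≡ y

    component-σ : ∀ {σ x} → Component σ x (σ x)
    component-σ = Eq.return (inj₁ refl)

    component-α : ∀ {σ x} → Component σ x (α x)
    component-α = Eq.return (inj₂ refl)

    -- Only the half of Euler's formula that expresses genus 0 is kept: it is the half that survives
    -- cutting and that bounds edges from above. `edges` is the same for every `σ`, because cutting
    -- keeps all darts. Counting classes needs decidable relations, hence the other fields.
    record Eulerian (σ : Fin N → Fin N) : Set where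
      field
        vertex?    : Decidable (Orbit σ)
        face?      : Decidable (Face σ)
        component? : Decidable (Component σ)
        euler      : edges + 2 * classes component? ≤ classes vertex? + classes face?

    module _ {σ : Fin N → Fin N} (σ-inj : Injective σ) (σ-A : ∀ x → A (σ x) ≡ A x)
             (d : Fin N) (Ad : T (A d)) (σd≢d : σ d ≢ d) where
      open Unhook σ d

      private
        b = σ d
        φ′ : Fin N → Fin N
        φ′ = unhook ∘ α

        Ab : T (A b)
        Ab = subst T (sym (σ-A d)) Ad

      unhook-A : ∀ x → A (unhook x) ≡ A x
      unhook-A x with view x
      ... | cut refl e     = cong A e
      ... | bypass _ p q   = trans (cong A q) (trans (σ-A d) (trans (cong A (sym p)) (σ-A x)))
      ... | ordinary _ _ e = trans (cong A e) (σ-A x)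

      private
        orbit-unhook-⊆ : Orbit unhook ⇒ Orbit σ
        orbit-unhook-⊆ = Eq.fold (Eq.isEquivalence _) λ { {x} refl → unhook-⊆ x }

        unhook-isolates : ¬ Orbit unhook d b
        unhook-isolates r = σd≢d (fixed-isolated (unhook-injective σ-inj) unhook-self r refl)

        face-join : Face unhook ⇒ Join (Face σ) d b
        face-join = Eq.fold (join-isEquivalence (Eq.isEquivalence _)) λ { {x} refl → step x }
          where
          step : ∀ x → Join (Face σ) d b x (φ′ x)
          step x with view (α x)
          ... | cut p q        = inj₂ (inj₂ (subst (Face σ x) (cong σ p) orbit-step , subst (Face σ d) (sym q) ε))
          ... | bypass _ p q   = inj₂ (inj₁ (subst (Face σ x) p orbit-step , subst (Face σ b) (sym q) ε))
          ... | ordinary _ _ q = inj₁ (subst (Face σ x) (sym q) orbit-step)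

        component-join : Component σ ⇒ Join (Component unhook) d b
        component-join = Eq.fold (join-isEquivalence (Eq.isEquivalence _))
          λ { {x} (inj₁ refl) → step x ; (inj₂ refl) → inj₁ component-α }
          where
          step : ∀ x → Join (Component unhook) d b x (σ x)
          step x with view x
          ... | cut refl _     = inj₂ (inj₁ (ε , ε))
          ... | bypass _ p q   = inj₂ (inj₂ (subst (Component unhook x) q component-σ , subst (Component unhook d) (sym p) ε))
          ... | ordinary _ _ q = inj₁ (subst (Component unhook x) q component-σ)

        face⊆component : Face unhook ⇒ Component unhook
        face⊆component = Eq.fold (Eq.isEquivalence _) λ { refl → component-α ◅◅ component-σ }

        -- If d is not on the face of b = σ d after the cut, then the face of b used to lead on to d.
        face-merged : ¬ Face unhook d b → Face σ b d
        face-merged ¬r = go b (φ′ b) b ε refl (injective-returns φ′-inj b) refl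
          where
          φ′-inj : Injective φ′
          φ′-inj = α-injective ∘ unhook-injective σ-inj
          go : ∀ x y z → Face unhook b x → φ′ x ≡ y → Star (λ x y → φ′ x ≡ y) y z → z ≡ b → Face σ x d
          go x y z r e path z≡b with view (α x)
          ... | cut _ q = ⊥-elim (¬r (Eq.symmetric _ (r ◅◅ subst (Face unhook x) q orbit-step)))
          ... | bypass _ p _ = subst (Face σ x) p orbit-step
          -- An ordinary step back to `b`, which is `σ d`, would force `α x ≡ d` by injectivity;
          -- hence the walk meets one of the cases above before it closes.
          go x y .y r e ε y≡b | ordinary αx≢d _ q = ⊥-elim (αx≢d (σ-inj (trans (sym q) (trans e y≡b))))
          go x y z r e (e′ ◅ path) z≡b | ordinary _ _ q =
            subst (Face σ x) (trans (sym q) e) orbit-step ◅◅ go y _ z (r ◅◅ subst (Face unhook x) e orbit-step) e′ path z≡b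

        face-A : Face unhook ⇒ λ x y → A x ≡ A y
        face-A = orbit-invariant A λ x → trans (unhook-A (α x)) (α-A x)

        orbit-A : Orbit unhook ⇒ λ x y → A x ≡ A y
        orbit-A = orbit-invariant A unhook-A

      -- The cut separates `d` from `b`, so V grows. If `d` and `b` share a face afterwards, they
      -- are still connected, so C does not grow, and F drops by at most 1. Otherwise a face has
      -- been split, so F grows as well, and these two gains pay for the at most one new component,
      -- which counts twice.
      unhook-eulerian : Eulerian σ → ¬ ¬ Eulerian unhook
      unhook-eulerian E k =
        ¬¬-decidable (Orbit unhook) λ v? → ¬¬-decidable (Face unhook) λ f? → ¬¬-decidable (Component unhook) λ c? →
        k (record { vertex? = v? ; face? = f? ; component? = c? ; euler = inequality v? f? c? })
        where
        open Eulerian E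
        open ≤-Reasoning
        vertices< : ∀ v? → classes vertex? < classes {Orbit unhook} v?
        vertices< v? = classes-refine-< vertex? v? (Eq.isEquivalence _) (Eq.isEquivalence _)
          orbit-unhook-⊆ orbit-A Ad Ab orbit-step unhook-isolates
        inequality : ∀ v? f? c? → edges + 2 * classes {Component unhook} c? ≤ classes {Orbit unhook} v? + classes {Face unhook} f?
        inequality v? f? c? with f? d b
        ... | yes r = begin
          edges + 2 * classes c?
            ≤⟨ +-monoʳ-≤ edges (*-monoʳ-≤ 2 (classes-refine c? component? λ c → join-collapse (Eq.isEquivalence _) (face⊆component r) (component-join c))) ⟩
          edges + 2 * classes component?        ≤⟨ euler ⟩
          classes vertex? + classes face?       ≤⟨ +-monoʳ-≤ (classes vertex?) (classes-join face? f? (Eq.isEquivalence _) face-join) ⟩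
          classes vertex? + suc (classes f?)    ≡⟨ +-suc (classes vertex?) (classes f?) ⟩
          suc (classes vertex?) + classes f?    ≤⟨ +-monoˡ-≤ (classes f?) (vertices< v?) ⟩
          classes v? + classes f?               ∎
        ... | no ¬r = begin
          edges + 2 * classes c?
            ≤⟨ +-monoʳ-≤ edges (*-monoʳ-≤ 2 (classes-join c? component? (Eq.isEquivalence _) component-join)) ⟩
          edges + 2 * suc (classes component?)    ≡⟨ shift edges (classes component?) ⟩
          2 + (edges + 2 * classes component?)    ≤⟨ +-monoʳ-≤ 2 euler ⟩
          2 + (classes vertex? + classes face?)   ≡⟨ cong suc (sym (+-suc (classes vertex?) (classes face?))) ⟩
          suc (classes vertex?) + suc (classes face?) ≤⟨ +-mono-≤ (vertices< v?) F< ⟩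
          classes v? + classes f?                 ∎
          where
          shift : ∀ e c → e + 2 * suc c ≡ 2 + (e + 2 * c)
          shift = solve-∀
          F< : classes face? < classes f?
          F< = classes-refine-< face? f? (Eq.isEquivalence _) (Eq.isEquivalence _)
            (λ r → join-collapse (Eq.isEquivalence _) (Eq.symmetric _ (face-merged ¬r)) (face-join r)) face-A Ad Ab
            (Eq.symmetric _ (face-merged ¬r)) ¬r

  -- Cutting a map down to a subgraph, and Euler's inequality for the subgraph

  module Pruning {N} {V : Set} (A : Fin N → Bool) (α : Fin N → Fin N) (α-A : ∀ x → A (α x) ≡ A x)
    (α-involutive : ∀ x → α (α x) ≡ x) (edges : ℕ) (tail : Fin N → V)
    (B : Fin N → Bool) (B⊆A : ∀ {x} → T (B x) → T (A x)) where

    open Map A α α-A α-involutive edges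
    open Classes A

    -- The invariant of the cutting process. `B` holds the darts of the subgraph, and `linked` says
    -- that those leaving the same vertex have not been separated.
    record Rotates (σ : Fin N → Fin N) : Set where
      field
        injective : Injective σ
        σ-A       : ∀ x → A (σ x) ≡ A x
        σ-tail    : ∀ x → tail (σ x) ≡ tail x
        linked    : ∀ {x y} → T (B x) → T (B y) → tail x ≡ tail y → Orbit σ x y

    unhook-rotates : ∀ {σ} → Rotates σ → ∀ {d} → T (A d) → ¬ T (B d) → σ d ≢ d → Rotates (Unhook.unhook σ d)
    unhook-rotates {σ} rot {d} Ad ¬Bd σd≢d = record
      { injective = unhook-injective injective
      ; σ-A = unhook-A injective σ-A d Ad σd≢d
      ; σ-tail = unhook-tail
      ; linked = λ {x} {y} Bx By e →
          subst₂ (Orbit unhook) (skip-other (λ { refl → ¬Bd Bx })) (skip-other (λ { refl → ¬Bd By })) (skip-orbit (linked Bx By e))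
      }
      where
      open Rotates rot
      open Unhook σ d
      unhook-tail : ∀ x → tail (unhook x) ≡ tail x
      unhook-tail x with view x
      ... | cut refl e     = cong tail e
      ... | bypass _ p q   = trans (cong tail q) (trans (σ-tail d) (trans (cong tail (sym p)) (σ-tail x)))
      ... | ordinary _ _ e = trans (cong tail e) (σ-tail x)
      -- Moving `d` on to its successor maps every step of `σ` into an orbit of `unhook`. Darts of
      -- `B` differ from `d` and do not move, so they stay linked.
      skip : Fin N → Fin N
      skip x with x Fin.≟ d
      ... | yes _ = σ d
      ... | no _  = x
      skip-other : ∀ {x} → x ≢ d → skip x ≡ x
      skip-other {x} x≢d with x Fin.≟ d
      ... | yes x≡d = ⊥-elim (x≢d x≡d)
      ... | no _    = refl
      skip-d : skip d ≡ σ d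
      skip-d with d Fin.≟ d
      ... | yes _ = refl
      ... | no d≢d = ⊥-elim (d≢d refl)
      skip-step : ∀ x → Orbit unhook (skip x) (skip (σ x))
      skip-step x with view x
      ... | cut refl _ = subst₂ (Orbit unhook) (sym skip-d) (sym (skip-other σd≢d)) ε
      ... | bypass x≢d p q = subst₂ (Orbit unhook) (sym (skip-other x≢d)) (trans q (trans (sym skip-d) (cong skip (sym p)))) orbit-step
      ... | ordinary x≢d p q = subst₂ (Orbit unhook) (sym (skip-other x≢d)) (trans q (sym (skip-other p))) orbit-step
      skip-orbit : ∀ {x y} → Orbit σ x y → Orbit unhook (skip x) (skip y)
      skip-orbit = Eq.gfold (Eq.isEquivalence _) skip λ { {x} refl → skip-step x }

    Prunes : (Fin N → Fin N) → Fin N → Set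
    Prunes σ d = T (A d) → ¬ T (B d) → σ d ≡ d

    -- If `σ x` were outside `B`, it would be a fixed point, and injectivity would give `σ x ≡ x`,
    -- which is in `B`.
    pruned-B : ∀ {σ} → Rotates σ → (∀ d → Prunes σ d) → ∀ {x} → T (B x) → T (B (σ x))
    pruned-B {σ} rot prunes {x} Bx with T? (B (σ x))
    ... | yes p = p
    ... | no ¬p = ⊥-elim (¬p (subst (T ∘ B) (sym (injective (prunes (σ x) (subst T (sym (σ-A x)) (B⊆A Bx)) ¬p))) Bx))
      where open Rotates rot

    -- Darts outside `B` are cut off one at a time. The last component, that fixed points stay
    -- fixed, carries the darts already treated through the later cuts.
    prune : ∀ ds {σ} → Rotates σ → Eulerian σ →
      ¬ ¬ ∃ λ σ′ → Rotates σ′ × Eulerian σ′ × All (Prunes σ′) ds × (∀ x → σ x ≡ x → σ′ x ≡ x)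
    prune [] {σ} rot E k = k (σ , rot , E , [] , λ _ e → e)
    prune (d ∷ ds) {σ} rot E k with T? (A d) ×-dec (¬? (T? (B d)) ×-dec ¬? (σ d Fin.≟ d))
    ... | yes (Ad , ¬Bd , σd≢d) = unhook-eulerian (Rotates.injective rot) (Rotates.σ-A rot) d Ad σd≢d E λ E′ →
      prune ds (unhook-rotates rot Ad ¬Bd σd≢d) E′ λ { (σ′ , rot′ , E″ , done , keep) →
        k (σ′ , rot′ , E″ , (λ _ _ → keep d unhook-self) ∷ done , λ x e → keep x (keep-fixed x e)) }
      where
      open Unhook σ d
      keep-fixed : ∀ x → σ x ≡ x → unhook x ≡ x
      keep-fixed x e with view x
      ... | cut p q        = trans q (sym p)
      ... | bypass x≢d p _ = ⊥-elim (x≢d (trans (sym e) p))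
      ... | ordinary _ _ q = trans q e
    ... | no ¬p = prune ds rot E λ { (σ′ , rot′ , E′ , done , keep) →
        k (σ′ , rot′ , E′ , (λ Ad ¬Bd → keep d (fixed Ad ¬Bd)) ∷ done , keep) }
      where
      fixed : T (A d) → ¬ T (B d) → σ d ≡ d
      fixed Ad ¬Bd with σ d Fin.≟ d
      ... | yes e = e
      ... | no ne = ⊥-elim (¬p (Ad , ¬Bd , ne))

    module Bound (α-B : ∀ x → B (α x) ≡ B x) (α-free : ∀ {x} → T (A x) → α x ≢ x)
      (edges-A : count (λ x → T? (A x)) ≤ 2 * edges)
      {k} (vertex : Fin k → V) (_≟_ : Decidable {A = V} _≡_) (covers : ∀ {x} → T (B x) → ∃ λ i → tail x ≡ vertex i)
      {t} (Bt : T (B t))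
      {σ} (rot : Rotates σ) (E : Eulerian σ) (prunes : ∀ d → Prunes σ d)
      (g : ℕ) (girth : ∀ {x} → T (B x) → ∀ i → suc i < g → fold x (σ ∘ α) (suc i) ≢ x) where

      open Rotates rot
      open Eulerian E

      -- The darts of the graph outside the subgraph. All are fixed by `σ`, so an edge made of them
      -- is a component of its own, with two vertices and one face.
      X : Fin N → Set
      X x = T (A x) × ¬ T (B x)

      X? : ∀ x → Dec (X x)
      X? x = T? (A x) ×-dec ¬? (T? (B x))

      σ-B⁻¹ : ∀ {x} → T (B (σ x)) → T (B x)
      σ-B⁻¹ {x} Bσx with T? (B x)
      ... | yes p = p
      ... | no ¬p = subst (T ∘ B) (prunes x (subst T (σ-A x) (B⊆A Bσx)) ¬p) Bσx

      α-X : ∀ {x} → X x → X (α x)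
      α-X {x} (Ax , ¬Bx) = subst T (sym (α-A x)) Ax , λ Bαx → ¬Bx (subst T (α-B x) Bαx)

      α-X⁻¹ : ∀ {x} → X (α x) → X x
      α-X⁻¹ {x} Xαx = subst X (α-involutive x) (α-X Xαx)

      component-B : ∀ {x y} → Component σ x y → T (B x) → T (B y)
      component-B r = proj₁ (Eq.fold equiv (λ { {x} (inj₁ refl) → pruned-B rot prunes , σ-B⁻¹
                                               ; {x} (inj₂ refl) → subst T (sym (α-B x)) , subst T (α-B x) }) r)
        where
        equiv : IsEquivalence λ x y → (T (B x) → T (B y)) × (T (B y) → T (B x))
        equiv = record { refl = id , id ; sym = λ { (f , h) → h , f } ; trans = λ { (f , h) (f′ , h′) → f′ ∘ f , h ∘ h′ } }

      component-X : ∀ {x} → X x → ∀ {y} → Component σ y x → y ≡ x ⊎ y ≡ α x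
      component-X {x} Xx r = proj₂ (Eq.fold equiv step r) (inj₁ refl)
        where
        In : Fin N → Set
        In y = y ≡ x ⊎ y ≡ α x
        equiv : IsEquivalence λ y z → (In y → In z) × (In z → In y)
        equiv = record { refl = id , id ; sym = λ { (f , h) → h , f } ; trans = λ { (f , h) (f′ , h′) → f′ ∘ f , h ∘ h′ } }
        σ-fixed : ∀ {y} → In y → σ y ≡ y
        σ-fixed (inj₁ refl) = prunes _ (proj₁ Xx) (proj₂ Xx)
        σ-fixed (inj₂ refl) = prunes _ (proj₁ (α-X Xx)) (proj₂ (α-X Xx))
        α-In : ∀ {y} → In y → In (α y)
        α-In (inj₁ refl) = inj₂ refl
        α-In (inj₂ refl) = inj₁ (α-involutive x)
        step : ∀ {y z} → (σ y ≡ z ⊎ α y ≡ z) → (In y → In z) × (In z → In y)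
        step (inj₁ refl) = (λ p → subst In (sym (σ-fixed p)) p) , λ p → subst In (injective (σ-fixed p)) p
        step {y} (inj₂ refl) = α-In , λ p → subst In (α-involutive y) (α-In p)

      module _ {R : Rel (Fin N) 0ℓ} (R? : Decidable R) where
        onB? : ∀ x → Dec (T (B x) × Least R x)
        onB? x = T? (B x) ×-dec least? R? x

        onX? : ∀ x → Dec (X x × Least R x)
        onX? x = X? x ×-dec least? R? x

        classes-≤ : classes R? ≤ count onB? + count onX?
        classes-≤ = ≤-trans (sum-mono λ x → 𝟙-cover (least∈? R? x) (onB? x) (onX? x) (λ { (Ax , l) → split Ax l }))
                            (≤-reflexive (∑-distrib-+ (λ x → 𝟙 (onB? x)) (λ x → 𝟙 (onX? x))))
          where
          split : ∀ {x} → T (A x) → Least R x → (T (B x) × Least R x) ⊎ (X x × Least R x)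
          split {x} Ax l with T? (B x)
          ... | yes p = inj₁ (p , l)
          ... | no ¬p = inj₂ ((Ax , ¬p) , l)

        classes-≥ : count onB? + count onX? ≤ classes R?
        classes-≥ = ≤-trans (≤-reflexive (sym (∑-distrib-+ (λ x → 𝟙 (onB? x)) (λ x → 𝟙 (onX? x)))))
          (sum-mono λ x → 𝟙-disjoint (onB? x) (onX? x) (least∈? R? x)
            (λ { (Bx , l) → B⊆A Bx , l }) (λ { ((Ax , _) , l) → Ax , l }) (λ { (Bx , _) ((_ , ¬Bx) , _) → ¬Bx Bx }))

        -- Counting a dart together with its reverse avoids halving: faces and components are
        -- compared, doubled, with the number of darts.
        reflected : count onX? + count onX? ≡ sum λ x → 𝟙 (onX? x) + 𝟙 (onX? (α x))
        reflected = trans (cong (count onX? +_) (sym (sum-injective α-injective (λ x → 𝟙 (onX? x)))))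
                          (sym (∑-distrib-+ (λ x → 𝟙 (onX? x)) (λ x → 𝟙 (onX? (α x)))))

      dartsB dartsX : ℕ
      dartsB = count λ x → T? (B x)
      dartsX = count X?

      darts : dartsB + dartsX ≤ 2 * edges
      darts = ≤-trans (≤-trans (≤-reflexive (sym (∑-distrib-+ (λ x → 𝟙 (T? (B x))) (λ x → 𝟙 (X? x)))))
        (sum-mono λ x → 𝟙-disjoint (T? (B x)) (X? x) (T? (A x)) B⊆A proj₁ (λ { Bx (_ , ¬Bx) → ¬Bx Bx }))) edges-A

      verticesB : count (onB? vertex?) ≤ k
      verticesB = ≤-trans (count-inject (onB? vertex?) (λ (i : Fin k) → yes tt) (λ x i → tail x ≟ vertex i)
        (λ { (Bx , _) → let i , e = covers Bx in i , tt , e })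
        (λ { (Bx , l) (By , l′) _ e e′ → least-unique (Eq.isEquivalence _) l l′ (linked Bx By (trans e (sym e′))) }))
        (count≤ (λ (i : Fin k) → yes tt))

      verticesX : count (onX? vertex?) ≤ dartsX
      verticesX = count-mono (onX? vertex?) X? proj₁

      facesX : count (onX? face?) + count (onX? face?) ≤ dartsX
      facesX = ≤-trans (≤-reflexive (reflected face?)) (sum-mono λ x →
        𝟙-disjoint (onX? face? x) (onX? face? (α x)) (X? x) proj₁ (α-X⁻¹ ∘ proj₁)
          λ { (Xx , l) (Xαx , l′) → α-free (proj₁ Xx) (sym (least-unique (Eq.isEquivalence _) l l′
            (subst (Face σ x) (prunes _ (proj₁ Xαx) (proj₂ Xαx)) orbit-step))) })

      componentsX : dartsX ≤ count (onX? component?) + count (onX? component?)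
      componentsX = ≤-trans (sum-mono λ x → 𝟙-cover (X? x) (onX? component? x) (onX? component? (α x)) (pick x))
                            (≤-reflexive (sym (reflected component?)))
        where
        pick : ∀ x → X x → (X x × Least (Component σ) x) ⊎ (X (α x) × Least (Component σ) (α x))
        pick x Xx with Fin.≤-total x (α x)
        ... | inj₁ x≤αx = inj₁ (Xx , λ y r → bound (component-X Xx r))
          where
          bound : ∀ {y} → y ≡ x ⊎ y ≡ α x → x Fin.≤ y
          bound (inj₁ refl) = ≤-refl
          bound (inj₂ refl) = x≤αx
        ... | inj₂ αx≤x = inj₂ (α-X Xx , λ y r → bound (component-X (α-X Xx) r))
          where
          bound : ∀ {y} → y ≡ α x ⊎ y ≡ α (α x) → α x Fin.≤ y
          bound (inj₁ refl) = ≤-refl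
          bound (inj₂ refl) = subst (λ z → toℕ (α x) ≤ toℕ z) (sym (α-involutive x)) αx≤x

      componentsB : 1 ≤ count (onB? component?)
      componentsB with least-exists (Eq.isEquivalence _) component? t
      ... | m , r , l = count-∃ (onB? component?) {m} (component-B (Eq.symmetric _ r) Bt , l)

      private
        φ : Fin N → Fin N
        φ = σ ∘ α

        φ-injective : Injective φ
        φ-injective = α-injective ∘ injective

        φ^ : ℕ → Fin N → Fin N
        φ^ i x = fold x φ i

        φ^-injective : ∀ i → Injective (φ^ i)
        φ^-injective zero    e = e
        φ^-injective (suc i) e = φ^-injective i (φ-injective e)

        φ^-face : ∀ i x → Face σ x (φ^ i x)
        φ^-face zero    x = ε
        φ^-face (suc i) x = φ^-face i x ◅◅ orbit-step

        φ^-B⁻¹ : ∀ i {x} → T (B (φ^ i x)) → T (B x)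
        φ^-B⁻¹ zero    p = p
        φ^-B⁻¹ (suc i) p = φ^-B⁻¹ i (subst T (α-B _) (σ-B⁻¹ p))

      -- For each `i` below `g`, a least dart is charged to the dart `i` steps before it on its
      -- face. The `girth` hypothesis makes the first `g` iterates of a dart distinct, so no dart of
      -- `B` is charged twice.
      facesB : g * count (onB? face?) ≤ dartsB
      facesB = begin
        g * count (onB? face?)                             ≡⟨ sym (sum-const g _) ⟩
        (sum λ (i : Fin g) → count (onB? face?))
          ≡⟨ sum-cong-≗ {n = g} (λ i → sym (sum-injective (φ^-injective (toℕ i)) (λ x → 𝟙 (onB? face? x)))) ⟩
        (sum λ (i : Fin g) → sum λ x → 𝟙 (onB? face? (φ^ (toℕ i) x))) ≡⟨ ∑-comm (λ (i : Fin g) x → 𝟙 (onB? face? (φ^ (toℕ i) x))) ⟩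
        (sum λ x → sum λ (i : Fin g) → 𝟙 (onB? face? (φ^ (toℕ i) x))) ≤⟨ sum-mono once ⟩
        dartsB                                             ∎
        where
        open ≤-Reasoning
        returns : ∀ {x} → T (B x) → ∀ i j → i < j → j < g → φ^ i x ≢ φ^ j x
        returns {x} Bx i j i<j j<g e with m≤n⇒∃[o]m+o≡n i<j
        ... | o , refl = girth Bx o (≤-<-trans (s≤s (m≤n+m o i)) j<g)
          (sym (fold-cancel φ-injective i (trans e (cong (λ j → φ^ j x) (sym (+-suc i o))))))
        same : ∀ {x} → T (B x) → {i j : Fin g} → T (B (φ^ (toℕ i) x)) × Least (Face σ) (φ^ (toℕ i) x) →
               T (B (φ^ (toℕ j) x)) × Least (Face σ) (φ^ (toℕ j) x) → i ≡ j
        same {x} Bx {i} {j} (_ , l) (_ , l′) with <-cmp (toℕ i) (toℕ j)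
          | least-unique (Eq.isEquivalence _) l l′ (Eq.symmetric _ (φ^-face (toℕ i) x) ◅◅ φ^-face (toℕ j) x)
        ... | tri< i<j _ _ | e = ⊥-elim (returns Bx _ _ i<j (Fin.toℕ<n j) e)
        ... | tri≈ _ i≡j _ | _ = Fin.toℕ-injective i≡j
        ... | tri> _ _ j<i | e = ⊥-elim (returns Bx _ _ j<i (Fin.toℕ<n i) (sym e))
        once : ∀ x → count (λ (i : Fin g) → onB? face? (φ^ (toℕ i) x)) ≤ 𝟙 (T? (B x))
        once x with T? (B x)
        ... | yes Bx = ≤-trans (count-unique (λ (i : Fin g) → onB? face? (φ^ (toℕ i) x)) (same Bx))
                               (≤-reflexive (sym (𝟙-yes (T? (B x)) Bx)))
        ... | no ¬Bx = ≤-trans (≤-reflexive (count≡0 (λ (i : Fin g) → onB? face? (φ^ (toℕ i) x)) λ i p → ¬Bx (φ^-B⁻¹ (toℕ i) (proj₁ p)))) z≤n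

      euler-B : dartsB + 4 ≤ 2 * (k + count (onB? face?))
      -- After doubling, the edges outside the subgraph contribute `dartsX` for E and `2 * dartsX`
      -- for 2C on one side, `2 * dartsX` for V and `dartsX` for F on the other. These cancel, and
      -- at least one component of the subgraph remains.
      euler-B = +-cancelʳ-≤ (3 * dartsX) _ _ (begin
        dartsB + 4 + 3 * dartsX                               ≡⟨ regroup₁ dartsB dartsX ⟩
        dartsB + dartsX + 2 * (2 + dartsX)
          ≤⟨ +-mono-≤ darts (*-monoʳ-≤ 2 (+-mono-≤ (*-monoʳ-≤ 2 componentsB) componentsX)) ⟩
        2 * edges + 2 * (2 * cB + (cX + cX))                  ≡⟨ regroup₂ edges cB cX ⟩
        2 * (edges + 2 * (cB + cX))                           ≤⟨ *-monoʳ-≤ 2 (+-monoʳ-≤ edges (*-monoʳ-≤ 2 (classes-≥ component?))) ⟩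
        2 * (edges + 2 * classes component?)                  ≤⟨ *-monoʳ-≤ 2 euler ⟩
        2 * (classes vertex? + classes face?)                 ≤⟨ *-monoʳ-≤ 2 (+-mono-≤ (classes-≤ vertex?) (classes-≤ face?)) ⟩
        2 * (count (onB? vertex?) + count (onX? vertex?) + (fB + fX)) ≤⟨ *-monoʳ-≤ 2 (+-monoˡ-≤ (fB + fX) (+-mono-≤ verticesB verticesX)) ⟩
        2 * (k + dartsX + (fB + fX))                          ≡⟨ regroup₃ k dartsX fB fX ⟩
        2 * (k + fB) + (2 * dartsX + (fX + fX))               ≤⟨ +-monoʳ-≤ (2 * (k + fB)) (+-monoʳ-≤ (2 * dartsX) facesX) ⟩
        2 * (k + fB) + (2 * dartsX + dartsX)                  ≡⟨ regroup₄ (2 * (k + fB)) dartsX ⟩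
        2 * (k + fB) + 3 * dartsX                             ∎)
        where
        open ≤-Reasoning
        cB cX fB fX : ℕ
        cB = count (onB? component?)
        cX = count (onX? component?)
        fB = count (onB? face?)
        fX = count (onX? face?)
        regroup₁ : ∀ a x → a + 4 + 3 * x ≡ a + x + 2 * (2 + x)
        regroup₁ = solve-∀
        regroup₂ : ∀ e b x → 2 * e + 2 * (2 * b + (x + x)) ≡ 2 * (e + 2 * (b + x))
        regroup₂ = solve-∀
        regroup₃ : ∀ k d b x → 2 * (k + d + (b + x)) ≡ 2 * (k + b) + (2 * d + (x + x))
        regroup₃ = solve-∀
        regroup₄ : ∀ a d → a + (2 * d + d) ≡ a + 3 * d
        regroup₄ = solve-∀

  -- The combinatorial map of a plane graph

  does-sound : ∀ {P : Set} (p : Dec P) → T (does p) → P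
  does-sound (yes p) _ = p

  does-complete : ∀ {P : Set} (p : Dec P) → P → T (does p)
  does-complete (yes _) _ = tt
  does-complete (no ¬p) p = ¬p p

  T-ext : ∀ {a b} → (T a → T b) → (T b → T a) → a ≡ b
  T-ext {true}  {true}  _ _ = refl
  T-ext {false} {false} _ _ = refl
  T-ext {true}  {false} f _ = ⊥-elim (f tt)
  T-ext {false} {true}  _ g = ⊥-elim (g tt)

  length-filter-map-tabulate : ∀ {A B : Set} {P : B → Set} (P? : ∀ x → Dec (P x)) (g : A → B) {n} (f : Fin n → A) →
    length (filter P? (map g (tabulate f))) ≡ count (λ i → P? (g (f i)))
  length-filter-map-tabulate P? g {zero}  f = refl
  length-filter-map-tabulate P? g {suc n} f with P? (g (f zero))
  ... | yes _ = cong suc (length-filter-map-tabulate P? g (f ∘ suc))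
  ... | no _  = length-filter-map-tabulate P? g (f ∘ suc)

  length-filter-tabulate : ∀ {A : Set} {P : A → Set} (P? : ∀ x → Dec (P x)) {n} (f : Fin n → A) →
    length (filter P? (tabulate f)) ≡ count (λ i → P? (f i))
  length-filter-tabulate P? {zero}  f = refl
  length-filter-tabulate P? {suc n} f with P? (f zero)
  ... | yes _ = cong suc (length-filter-tabulate P? (f ∘ suc))
  ... | no _  = length-filter-tabulate P? (f ∘ suc)

  length-filter-product : ∀ {A B : Set} {P : A × B → Set} (P? : ∀ x → Dec (P x)) {m n} (f : Fin m → A) (g : Fin n → B) →
    length (filter P? (cartesianProduct (tabulate f) (tabulate g))) ≡ sum λ i → count λ j → P? (f i , g j)
  length-filter-product P? {zero}  f g = refl
  length-filter-product P? {suc m} f g = begin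
    length (filter P? (map (f zero ,_) (tabulate g) ++ rest))
      ≡⟨ cong length (filter-++ P? (map (f zero ,_) (tabulate g)) rest) ⟩
    length (filter P? (map (f zero ,_) (tabulate g)) ++ filter P? rest)
      ≡⟨ length-++ (filter P? (map (f zero ,_) (tabulate g))) ⟩
    length (filter P? (map (f zero ,_) (tabulate g))) + length (filter P? rest)
      ≡⟨ cong₂ _+_ (length-filter-map-tabulate P? (f zero ,_) g) (length-filter-product P? (f ∘ suc) g) ⟩
    count (λ j → P? (f zero , g j)) + (sum λ i → count λ j → P? (f (suc i) , g j)) ∎
    where
    open ≡-Reasoning
    rest = cartesianProduct (tabulate (f ∘ suc)) (tabulate g)

  star-fold : ∀ {A : Set} {f : A → A} {x y} → Star (λ x y → f x ≡ y) x y → ∃ λ k → fold x f k ≡ y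
  star-fold ε = 0 , refl
  star-fold {f = f} {x} (refl ◅ path) with star-fold path
  ... | k , e = suc k , trans (sym (fold-shift f x k)) e

  fold-period : ∀ {A : Set} (f : A → A) {x} p → fold x f p ≡ x → ∀ m → fold x f (m * p) ≡ x
  fold-period f p e zero    = refl
  fold-period f {x} p e (suc m) = trans (fold-+ x f p) (trans (cong (λ y → fold y f p) (fold-period f p e m)) e)

  -- Both u and w are found on the cycle through f u = f w, at the same position modulo the length of the cycle.
  cyclic-injective : ∀ {A : Set} (f : A → A) {u w} → f u ≡ f w →
    Star (λ x y → f x ≡ y) (f u) u → Star (λ x y → f x ≡ y) (f w) w → u ≡ w
  cyclic-injective f {u} {w} e p q with star-fold p | star-fold q
  ... | k , eu | l , ew = begin
    u                             ≡⟨ sym (at (f u) k eu l refl) ⟩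
    fold (f u) f (k + l * suc k)  ≡⟨ cong₂ (λ z i → fold z f i) e (commute k l) ⟩
    fold (f w) f (l + k * suc l)  ≡⟨ at (f w) l ew k refl ⟩
    w                             ∎
    where
    open ≡-Reasoning
    commute : ∀ k l → k + l * suc k ≡ l + k * suc l
    commute = solve-∀
    at : ∀ z {v} k → fold z f k ≡ v → ∀ l → f v ≡ z → fold z f (k + l * suc k) ≡ v
    at z k ev l refl′ = trans (fold-+ z f k) (trans (cong (λ y → fold y f k) (fold-period f (suc k) (trans (cong f ev) refl′) l)) ev)

  module Darts {n} (G : Graph n) where
    open Graph G

    -- All ordered pairs of vertices, so that rotation and reversal are self-maps of one `Fin` type.
    -- `A` marks the adjacent pairs, and `σ₀` fixes the rest.
    D : Set
    D = Fin (n * n)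

    tl hd : D → Fin n
    tl x = proj₁ (remQuot {n} n x)
    hd x = proj₂ (remQuot {n} n x)

    arc : Fin n → Fin n → D
    arc = combine

    tl-arc : ∀ u v → tl (arc u v) ≡ u
    tl-arc u v = cong proj₁ (remQuot-combine u v)

    hd-arc : ∀ u v → hd (arc u v) ≡ v
    hd-arc u v = cong proj₂ (remQuot-combine u v)

    arc-tl-hd : ∀ x → arc (tl x) (hd x) ≡ x
    arc-tl-hd = combine-remQuot {n} n

    α : D → D
    α x = arc (hd x) (tl x)

    α-involutive : ∀ x → α (α x) ≡ x
    α-involutive x = trans (cong₂ arc (hd-arc _ _) (tl-arc _ _)) (arc-tl-hd x)

    A : D → Bool
    A x = adj (tl x) (hd x)

    A-arc : ∀ {u v} → u ~ v → T (A (arc u v))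
    A-arc {u} {v} = subst T (sym (cong₂ adj (tl-arc u v) (hd-arc u v)))

    α-A : ∀ x → A (α x) ≡ A x
    α-A x = trans (cong₂ adj (tl-arc _ _) (hd-arc _ _)) (adj-sym (hd x) (tl x))

    α-free : ∀ {x} → T (A x) → tl x ≢ hd x
    α-free {x} Ax e = subst T (trans (cong (adj (tl x)) (sym e)) (adj-irrefl (tl x))) Ax

    degreeSum : ℕ
    degreeSum = sum λ u → count λ v → T? (adj u v)

    edgeCount-sum : edgeCount ≡ sum λ u → count λ v → edge? (u , v)
    edgeCount-sum = length-filter-product edge? id id

    private
      doubled : 2 * edgeCount ≡ sum λ u → sum λ v → 𝟙 (edge? (u , v)) + 𝟙 (edge? (v , u))
      doubled = begin
        2 * edgeCount                ≡⟨ cong (edgeCount +_) (+-identityʳ edgeCount) ⟩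
        edgeCount + edgeCount        ≡⟨ cong₂ _+_ edgeCount-sum (trans edgeCount-sum (∑-comm (λ u v → 𝟙 (edge? (u , v))))) ⟩
        (sum λ u → sum λ v → 𝟙 (edge? (u , v))) + (sum λ u → sum λ v → 𝟙 (edge? (v , u)))
          ≡⟨ sym (∑-distrib-+ (λ u → sum λ v → 𝟙 (edge? (u , v))) (λ u → sum λ v → 𝟙 (edge? (v , u)))) ⟩
        (sum λ u → (sum λ v → 𝟙 (edge? (u , v))) + (sum λ v → 𝟙 (edge? (v , u))))
          ≡⟨ sum-cong-≗ (λ u → sym (∑-distrib-+ (λ v → 𝟙 (edge? (u , v))) (λ v → 𝟙 (edge? (v , u))))) ⟩
        (sum λ u → sum λ v → 𝟙 (edge? (u , v)) + 𝟙 (edge? (v , u))) ∎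
        where open ≡-Reasoning

    2*edgeCount≤degreeSum : 2 * edgeCount ≤ degreeSum
    2*edgeCount≤degreeSum = ≤-trans (≤-reflexive doubled) (sum-mono λ u → sum-mono λ v →
      𝟙-disjoint (edge? (u , v)) (edge? (v , u)) (T? (adj u v)) proj₂ (~-sym ∘ proj₂)
        λ { (u<v , _) (v<u , _) → <-asym u<v v<u })

    degreeSum≤2*edgeCount : degreeSum ≤ 2 * edgeCount
    degreeSum≤2*edgeCount = ≤-trans (sum-mono λ u → sum-mono λ v →
      𝟙-cover (T? (adj u v)) (edge? (u , v)) (edge? (v , u)) (orient u v)) (≤-reflexive (sym doubled))
      where
      orient : ∀ u v → u ~ v → Edge (u , v) ⊎ Edge (v , u)
      orient u v u~v with Fin.<-cmp u v
      ... | tri< u<v _ _  = inj₁ (u<v , u~v)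
      ... | tri≈ _ refl _ = ⊥-elim (subst T (adj-irrefl u) u~v)
      ... | tri> _ _ v<u  = inj₂ (v<u , ~-sym u~v)

    edges-A : count (λ x → T? (A x)) ≤ 2 * edgeCount
    edges-A = ≤-trans (≤-reflexive (trans (sum-combine n {n} (λ x → 𝟙 (T? (A x))))
      (sum-cong-≗ λ u → sum-cong-≗ λ v → cong (λ b → 𝟙 (T? b)) (cong₂ adj (tl-arc u v) (hd-arc u v))))) degreeSum≤2*edgeCount

    module Embedded (planar : Planar G) where
      open Planar planar
      open Rotation rotation
      open Map A α α-A α-involutive edgeCount public
      open Classes A

      σ₀ : D → D
      σ₀ x = if A x then arc (tl x) (next (tl x) (hd x)) else x

      σ₀-dart : ∀ {x} → T (A x) → σ₀ x ≡ arc (tl x) (next (tl x) (hd x))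
      σ₀-dart {x} Ax with A x
      ... | true = refl

      σ₀-tail : ∀ x → tl (σ₀ x) ≡ tl x
      σ₀-tail x with A x
      ... | true  = tl-arc _ _
      ... | false = refl

      σ₀-arc : ∀ {u v} → u ~ v → σ₀ (arc u v) ≡ arc u (next u v)
      σ₀-arc {u} {v} u~v = trans (σ₀-dart (A-arc u~v)) (cong₂ (λ u v → arc u (next u v)) (tl-arc u v) (hd-arc u v))

      σ₀-A : ∀ x → A (σ₀ x) ≡ A x
      σ₀-A x = T-ext back (λ Ax → subst (T ∘ A) (sym (σ₀-dart Ax)) (A-arc (next-~ Ax)))
        where
        back : T (A (σ₀ x)) → T (A x)
        back with A x in eq
        ... | true  = λ _ → tt
        ... | false = subst T eq

      σ₀-injective : Injective σ₀
      σ₀-injective {x} {y} e with T? (A x) | T? (A y)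
      ... | no ¬Ax | no ¬Ay = trans (sym (σ₀-off ¬Ax)) (trans e (σ₀-off ¬Ay))
        where
        σ₀-off : ∀ {x} → ¬ T (A x) → σ₀ x ≡ x
        σ₀-off {x} ¬Ax with A x
        ... | true  = ⊥-elim (¬Ax tt)
        ... | false = refl
      ... | yes Ax | no ¬Ay = ⊥-elim (¬Ay (subst T (trans (sym (σ₀-A x)) (trans (cong A e) (σ₀-A y))) Ax))
      ... | no ¬Ax | yes Ay = ⊥-elim (¬Ax (subst T (trans (sym (σ₀-A y)) (trans (cong A (sym e)) (σ₀-A x))) Ay))
      ... | yes Ax | yes Ay = trans (sym (arc-tl-hd x)) (trans (cong₂ arc tails heads) (arc-tl-hd y))
        where
        tails : tl x ≡ tl y
        tails = trans (sym (σ₀-tail x)) (trans (cong tl e) (σ₀-tail y))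
        u~y : tl x ~ hd y
        u~y = subst (_~ hd y) (sym tails) Ay
        nexts : next (tl x) (hd x) ≡ next (tl x) (hd y)
        nexts = trans (sym (hd-arc _ _)) (trans (cong hd (trans (sym (σ₀-dart Ax)) (trans e (σ₀-dart Ay))))
                  (trans (hd-arc _ _) (cong (λ u → next u (hd y)) (sym tails))))
        heads : hd x ≡ hd y
        heads = cyclic-injective (next (tl x)) nexts (cyclic (next-~ Ax) Ax) (cyclic (next-~ u~y) u~y)

      around : ∀ {v u w} → v ~ u → SameOrbit (next v) u w → Orbit σ₀ (arc v u) (arc v w)
      around v~u ε = ε
      around v~u (refl ◅ path) = subst (Orbit σ₀ _) (σ₀-arc v~u) orbit-step ◅◅ around (next-~ v~u) path

      σ₀-linked : ∀ {x y} → T (A x) → T (A y) → tl x ≡ tl y → Orbit σ₀ x y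
      σ₀-linked {x} {y} Ax Ay e = subst₂ (Orbit σ₀) (arc-tl-hd x) (trans (cong (λ u → arc u (hd y)) e) (arc-tl-hd y))
        (around Ax (cyclic Ax (subst (_~ hd y) (sym e) Ay)))

      private
        isolated : isolatedCount ≡ count isolated?
        isolated = length-filter-tabulate isolated? id

        mk : ∀ x → T (A x) → Dart
        mk x Ax = dart {tl x} {hd x} Ax

        dart-≡ : ∀ {u v u′ v′} (p : u ~ v) (q : u′ ~ v′) → u ≡ u′ → v ≡ v′ → dart p ≡ dart q
        dart-≡ p q refl refl = cong dart (T-irrelevant p q)

        neighbour : ∀ {u} → ¬ Isolated u → ∃ λ v → u ~ v
        neighbour {u} ¬iso with any? (λ v → T? (adj u v))
        ... | yes p = p
        ... | no ¬p = ⊥-elim (¬iso λ v u~v → ¬p (v , u~v))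

      vertices≥ : (v? : Decidable (Orbit σ₀)) → n ≤ classes v? + isolatedCount
      vertices≥ v? = begin
        n                                                   ≡⟨ sym (count-all (λ (u : Fin n) → yes tt) (λ _ → tt)) ⟩
        (sum λ (u : Fin n) → 1)
          ≤⟨ sum-mono {n = n} (λ u → 𝟙-cover (yes tt) (¬? (isolated? u)) (isolated? u) (λ _ → em u)) ⟩
        (sum λ u → 𝟙 (¬? (isolated? u)) + 𝟙 (isolated? u)) ≡⟨ ∑-distrib-+ (λ u → 𝟙 (¬? (isolated? u))) (λ u → 𝟙 (isolated? u)) ⟩
        count (¬? ∘ isolated?) + count isolated?
          ≤⟨ +-mono-≤ (count-inject (¬? ∘ isolated?) (least∈? v?) (λ u x → tl x Fin.≟ u) total (λ _ _ _ e e′ → trans (sym e) e′))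
                                                                (≤-reflexive (sym isolated)) ⟩
        classes v? + isolatedCount                          ∎
        where
        open ≤-Reasoning
        em : ∀ u → ¬ Isolated u ⊎ Isolated u
        em u with isolated? u
        ... | yes p = inj₂ p
        ... | no ¬p = inj₁ ¬p
        total : ∀ {u} → ¬ Isolated u → ∃ λ x → (T (A x) × Least (Orbit σ₀) x) × tl x ≡ u
        total {u} ¬iso with neighbour ¬iso
        ... | v , u~v with least-exists (Eq.isEquivalence _) v? (arc u v)
        ...   | m , r , l = m , (subst T (sym (orbit-invariant A σ₀-A r)) (A-arc u~v) , l) , trans (orbit-invariant tl σ₀-tail r) (tl-arc u v)

      private
        faceClass = proj₁ has-faces
        componentClass = proj₁ has-components

        -- `faceClass` needs a proof of adjacency, while the orbits run over all pairs. The first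
        -- component transports such a proof along an orbit.
        SameFace : Rel D 0ℓ
        SameFace x y = A x ≡ A y × (∀ Ax Ay → faceClass (mk x Ax) ≡ faceClass (mk y Ay))

        sameFace-isEquivalence : IsEquivalence SameFace
        sameFace-isEquivalence = record
          { refl = refl , λ p q → cong (faceClass ∘ mk _) (T-irrelevant p q)
          ; sym = λ { (e , h) → sym e , λ p q → sym (h q p) }
          ; trans = λ { (e , h) (e′ , h′) → trans e e′ , λ p q → trans (h p (subst T e p)) (h′ (subst T e p) q) }
          }

      face-class : Face σ₀ ⇒ SameFace
      face-class = Eq.fold sameFace-isEquivalence λ { {x} refl → sym (trans (σ₀-A (α x)) (α-A x)) , step x }
        where
        step : ∀ x (Ax : T (A x)) (Ay : T (A (σ₀ (α x)))) → faceClass (mk x Ax) ≡ faceClass (mk (σ₀ (α x)) Ay)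
        step x Ax Ay = trans (Equivalence.to (proj₂ (proj₂ has-faces) (mk x Ax) (faceStep (mk x Ax))) (refl ◅ ε))
          (cong faceClass (dart-≡ _ _ (sym (trans (cong tl turn) (tl-arc _ _))) (sym (trans (cong hd turn) (hd-arc _ _)))))
          where
          turn : σ₀ (α x) ≡ arc (hd x) (next (hd x) (tl x))
          turn = σ₀-arc (~-sym Ax)

      faces≥ : (f? : Decidable (Face σ₀)) → faces ≤ classes f?
      faces≥ f? = ≤-trans (≤-reflexive (sym (count-all (λ (c : Fin faces) → yes tt) (λ _ → tt))))
        (count-inject (λ (c : Fin faces) → yes tt) (least∈? f?) inFace? (λ {c} _ → total c)
          λ { _ _ _ (p , e) (q , e′) → trans (sym e) (trans (cong (faceClass ∘ mk _) (T-irrelevant p q)) e′) })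
        where
        inFace? : ∀ c x → Dec (Σ (T (A x)) λ Ax → faceClass (mk x Ax) ≡ c)
        inFace? c x with T? (A x)
        ... | no ¬Ax = no (¬Ax ∘ proj₁)
        ... | yes Ax with faceClass (mk x Ax) Fin.≟ c
        ...   | yes e = yes (Ax , e)
        ...   | no ¬e = no λ { (p , e) → ¬e (trans (cong (faceClass ∘ mk x) (T-irrelevant Ax p)) e) }
        total : ∀ c → ∃ λ x → (T (A x) × Least (Face σ₀) x) × Σ (T (A x)) λ Ax → faceClass (mk x Ax) ≡ c
        total c with proj₁ (proj₂ has-faces) c
        ... | dart {u} {v} u~v , hits with least-exists (Eq.isEquivalence _) f? (arc u v)
        ...   | m , r , l = m , (Am , l) , Am , trans (proj₂ (face-class r) Am (A-arc u~v)) (hits (dart-≡ _ _ (tl-arc u v) (hd-arc u v)))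
          where
          Am : T (A m)
          Am = subst T (sym (proj₁ (face-class r))) (A-arc u~v)

      component-tail : ∀ {x y} → T (A x) → T (A y) → Connected (tl x) (tl y) → Component σ₀ x y
      component-tail {x} {y} Ax Ay path = go x Ax _ refl path
        where
        orbit⊆component : Orbit σ₀ ⇒ Component σ₀
        orbit⊆component = Eq.fold (Eq.isEquivalence _) λ { refl → component-σ }
        go : ∀ x → T (A x) → ∀ u → u ≡ tl x → Connected u (tl y) → Component σ₀ x y
        go x Ax u e ε = orbit⊆component (σ₀-linked Ax Ay (sym e))
        go x Ax u e (_◅_ {j = w} u~w path) =
          orbit⊆component (σ₀-linked Ax (A-arc u~w) (trans (sym e) (sym (tl-arc u w)))) ◅◅ component-α ◅◅
          go (α (arc u w)) (subst T (sym (α-A (arc u w))) (A-arc u~w)) w (sym (trans (tl-arc _ _) (hd-arc u w))) path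

      -- Components of the map go injectively to connected components without an isolated vertex,
      -- isolated vertices to those with one.
      components≤ : (c? : Decidable (Component σ₀)) → classes c? + isolatedCount ≤ components
      components≤ c? = begin
        classes c? + isolatedCount                                ≤⟨ +-mono-≤ fromDarts (≤-trans (≤-reflexive isolated) fromIsolated) ⟩
        count (¬? ∘ hasIsolated?) + count hasIsolated?
          ≡⟨ sym (∑-distrib-+ (λ c → 𝟙 (¬? (hasIsolated? c))) (λ c → 𝟙 (hasIsolated? c))) ⟩
        (sum λ c → 𝟙 (¬? (hasIsolated? c)) + 𝟙 (hasIsolated? c))
          ≤⟨ sum-mono (λ c → 𝟙-disjoint (¬? (hasIsolated? c)) (hasIsolated? c) (yes tt) (λ _ → tt) (λ _ → tt) (λ ¬p p → ¬p p)) ⟩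
        (sum λ (c : Fin components) → 1)                          ≡⟨ count-all (λ (c : Fin components) → yes tt) (λ _ → tt) ⟩
        components                                                ∎
        where
        open ≤-Reasoning
        HasIsolated : Fin components → Set
        HasIsolated c = ∃ λ u → Isolated u × componentClass u ≡ c
        hasIsolated? : ∀ c → Dec (HasIsolated c)
        hasIsolated? c = any? λ u → isolated? u ×-dec componentClass u Fin.≟ c
        connected : ∀ {u v} → componentClass u ≡ componentClass v → Connected u v
        connected {u} {v} = Equivalence.from (proj₂ (proj₂ has-components) u v)
        alone : ∀ {u v} → Isolated u → Connected u v → u ≡ v
        alone iso ε = refl
        alone iso (u~w ◅ _) = ⊥-elim (iso _ u~w)
        fromDarts : classes c? ≤ count (¬? ∘ hasIsolated?)
        fromDarts = count-inject (least∈? c?) (¬? ∘ hasIsolated?) (λ x c → componentClass (tl x) Fin.≟ c)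
          (λ { {x} (Ax , _) → _ , (λ { (u , iso , e) → iso (hd x) (subst (_~ hd x) (sym (alone iso (connected e))) Ax) }) , refl })
          (λ { {x} {y} (Ax , l) (Ay , l′) _ e e′ → least-unique (Eq.isEquivalence _) l l′ (component-tail Ax Ay (connected (trans e (sym e′)))) })
        fromIsolated : count isolated? ≤ count hasIsolated?
        fromIsolated = count-inject isolated? hasIsolated? (λ u c → componentClass u Fin.≟ c)
          (λ {u} iso → _ , (u , iso , refl) , refl) (λ iso _ _ e e′ → alone iso (connected (trans e (sym e′))))

      -- Isolated vertices have no darts and are absent from the map. In Euler's equation each
      -- counts as one vertex, one face and one component, so it adds 2 on both sides and cancels.
      σ₀-eulerian : ¬ ¬ Eulerian σ₀
      σ₀-eulerian k = ¬¬-decidable (Orbit σ₀) λ v? → ¬¬-decidable (Face σ₀) λ f? → ¬¬-decidable (Component σ₀) λ c? →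
        k (record { vertex? = v? ; face? = f? ; component? = c? ; euler = inequality v? f? c? })
        where
        open ≤-Reasoning
        inequality : ∀ v? f? c? → edgeCount + 2 * classes {Component σ₀} c? ≤ classes {Orbit σ₀} v? + classes {Face σ₀} f?
        inequality v? f? c? = +-cancelʳ-≤ (2 * isolatedCount) _ _ (begin
          edgeCount + 2 * classes c? + 2 * isolatedCount    ≡⟨ regroup₁ edgeCount (classes c?) isolatedCount ⟩
          edgeCount + 2 * (classes c? + isolatedCount)      ≤⟨ +-monoʳ-≤ edgeCount (*-monoʳ-≤ 2 (components≤ c?)) ⟩
          edgeCount + 2 * components                        ≡⟨ sym euler ⟩
          n + (faces + isolatedCount)                       ≤⟨ +-mono-≤ (vertices≥ v?) (+-monoˡ-≤ isolatedCount (faces≥ f?)) ⟩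
          classes v? + isolatedCount + (classes f? + isolatedCount) ≡⟨ regroup₂ (classes v?) (classes f?) isolatedCount ⟩
          classes v? + classes f? + 2 * isolatedCount       ∎)
          where
          regroup₁ : ∀ e c i → e + 2 * c + 2 * i ≡ e + 2 * (c + i)
          regroup₁ = solve-∀
          regroup₂ : ∀ v f i → v + i + (f + i) ≡ v + f + 2 * i
          regroup₂ = solve-∀

  -- Edge bounds for subgraphs of planar graphs

  pairs : ∀ {k} → (Fin k → Fin k → Bool) → ℕ
  pairs b = sum λ i → count λ j → T? (b i j)

  -- `b` is the adjacency matrix of a subgraph on the vertices `f i`; its darts are the set `B` to
  -- which the map of `G` is pruned.
  module Pattern {n} {G : Graph n} (planar : Planar G) {k} (f : Fin k → Fin n) (f-injective : Injective f)
    (b : Fin k → Fin k → Bool) (b-sym : ∀ {i j} → T (b i j) → T (b j i)) (b⊆G : ∀ {i j} → T (b i j) → Graph._~_ G (f i) (f j))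
    (nonempty : ∃ λ i → ∃ λ j → T (b i j)) where

    open Graph G
    open Darts G
    open Embedded planar

    private
      InB : D → Set
      InB x = ∃ λ i → ∃ λ j → T (b i j) × f i ≡ tl x × f j ≡ hd x

      inB? : ∀ x → Dec (InB x)
      inB? x = any? λ i → any? λ j → T? (b i j) ×-dec (f i Fin.≟ tl x ×-dec f j Fin.≟ hd x)

    B : D → Bool
    B x = does (inB? x)

    B-sound : ∀ {x} → T (B x) → InB x
    B-sound {x} = does-sound (inB? x)

    B-complete : ∀ {x} → InB x → T (B x)
    B-complete {x} = does-complete (inB? x)

    B-arc : ∀ {i j} → T (b i j) → T (B (arc (f i) (f j)))
    B-arc {i} {j} p = B-complete (i , j , p , sym (tl-arc _ _) , sym (hd-arc _ _))

    B⊆A : ∀ {x} → T (B x) → T (A x)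
    B⊆A Bx with B-sound Bx
    ... | i , j , p , e , e′ = subst₂ _~_ e e′ (b⊆G p)

    α-B⁺ : ∀ {x} → T (B x) → T (B (α x))
    α-B⁺ Bx with B-sound Bx
    ... | i , j , p , e , e′ = B-complete (j , i , b-sym p , trans e′ (sym (tl-arc _ _)) , trans e (sym (hd-arc _ _)))

    α-B : ∀ x → B (α x) ≡ B x
    α-B x = T-ext (λ p → subst (T ∘ B) (α-involutive x) (α-B⁺ p)) α-B⁺

    pairs≤ : pairs b ≤ count (λ x → T? (B x))
    pairs≤ = begin
      pairs b
        ≡⟨ sum-cong-≗ {n = k} (λ i → sum-cong-≗ {n = k} λ j → cong (λ p → 𝟙 (T? (b (proj₁ p) (proj₂ p)))) (sym (remQuot-combine i j))) ⟩
      (sum λ i → sum λ j → 𝟙 (b? (combine {k} {k} i j))) ≡⟨ sym (sum-combine k {k} (λ e → 𝟙 (b? e))) ⟩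
      count b?                                  ≤⟨ count-inject b? (λ x → T? (B x)) (λ e x → arc (f (s e)) (f (t e)) Fin.≟ x)
                                                    (λ be → _ , B-arc be , refl)
                                                    (λ { {e} {e′} _ _ _ p q → unique e e′ (trans p (sym q)) }) ⟩
      count (λ x → T? (B x))                    ∎
      where
      open ≤-Reasoning
      s t : Fin (k * k) → Fin k
      s e = proj₁ (remQuot {k} k e)
      t e = proj₂ (remQuot {k} k e)
      b? : ∀ e → Dec (T (b (s e) (t e)))
      b? e = T? (b (s e) (t e))
      unique : ∀ e e′ → arc (f (s e)) (f (t e)) ≡ arc (f (s e′)) (f (t e′)) → e ≡ e′
      unique e e′ p = trans (sym (combine-remQuot {k} k e)) (trans (cong₂ combine
        (f-injective (trans (sym (tl-arc _ _)) (trans (cong tl p) (tl-arc _ _))))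
        (f-injective (trans (sym (hd-arc _ _)) (trans (cong hd p) (hd-arc _ _))))) (combine-remQuot {k} k e′))

    open Pruning A α α-A α-involutive edgeCount tl B B⊆A

    σ₀-rotates : Rotates σ₀
    σ₀-rotates = record
      { injective = σ₀-injective ; σ-A = σ₀-A ; σ-tail = σ₀-tail ; linked = λ Bx By → σ₀-linked (B⊆A Bx) (B⊆A By) }

    pruned : ¬ ¬ ∃ λ σ → Rotates σ × Eulerian σ × (∀ d → Prunes σ d)
    pruned h = σ₀-eulerian λ E → prune (allFin _) σ₀-rotates E λ { (σ , rot , E′ , all , _) →
      h (σ , rot , E′ , λ d → All.lookup all (∈-allFin d)) }

    module Faces {σ} (rot : Rotates σ) (prunes : ∀ d → Prunes σ d) where
      open Rotates rot

      φ : D → D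
      φ = σ ∘ α

      φ-B : ∀ {x} → T (B x) → T (B (φ x))
      φ-B = pruned-B rot prunes ∘ α-B⁺

      φ-tail : ∀ x → tl (φ x) ≡ hd x
      φ-tail x = trans (σ-tail (α x)) (tl-arc _ _)

      no-monogon : ∀ {x} → T (B x) → φ x ≢ x
      no-monogon {x} Bx e = α-free (B⊆A Bx) (trans (sym (cong tl e)) (φ-tail x))

      -- A face of two darts forces `σ` to fix both darts of an edge, which is then the only edge at
      -- each of its ends. The hypothesis provides a second one.
      no-digon : (∀ {i j} → T (b i j) → ∃ λ l → (T (b i l) × l ≢ j) ⊎ (T (b j l) × l ≢ i)) →
                 ∀ {x} → T (B x) → φ (φ x) ≢ x
      no-digon more {x} Bx e with B-sound Bx
      ... | i , j , p , fi≡ , fj≡ = contradict (more p)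
        where
        y : D
        y = α x
        σy≡y : σ y ≡ y
        σy≡y = trans (sym (arc-tl-hd (φ x))) (cong₂ arc (φ-tail x) (trans (sym (φ-tail (φ x))) (cong tl e)))
        σx≡x : σ x ≡ x
        σx≡x = trans (cong σ (sym (trans (cong α σy≡y) (α-involutive x)))) e
        contradict : (∃ λ l → (T (b i l) × l ≢ j) ⊎ (T (b j l) × l ≢ i)) → ⊥
        contradict (l , inj₁ (q , l≢j)) = l≢j (f-injective (trans (sym (hd-arc (f i) (f l))) (trans (cong hd same) (sym fj≡))))
          where
          same : arc (f i) (f l) ≡ x
          same = fixed-isolated injective σx≡x (linked Bx (B-arc q) (trans (sym fi≡) (sym (tl-arc _ _)))) refl
        contradict (l , inj₂ (q , l≢i)) = l≢i (f-injective (trans (sym (hd-arc (f j) (f l)))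
                                            (trans (cong hd same) (trans (hd-arc _ _) (sym fi≡)))))
          where
          same : arc (f j) (f l) ≡ y
          same = fixed-isolated injective σy≡y
            (linked (α-B⁺ Bx) (B-arc q) (trans (tl-arc _ _) (trans (sym fj≡) (sym (tl-arc _ _))))) refl

      -- Three darts closing up would be an odd closed walk in a properly 2-coloured graph.
      no-triangle : (c : Fin k → Bool) → (∀ {i j} → T (b i j) → c i ≢ c j) → ∀ {x} → T (B x) → φ (φ (φ x)) ≢ x
      no-triangle c proper {x} Bx e with B-sound Bx | B-sound (φ-B Bx) | B-sound (φ-B (φ-B Bx))
      ... | i , j , p , fi≡ , fj≡ | i′ , j′ , p′ , fi′≡ , fj′≡ | i″ , j″ , p″ , fi″≡ , fj″≡ =
        odd (c i) (c i′) (c i″) (subst (c i ≢_) (cong c j≡i′) (proper p)) (subst (c i′ ≢_) (cong c j′≡i″) (proper p′))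
          (subst (c i″ ≢_) (cong c j″≡i) (proper p″))
        where
        j≡i′ : j ≡ i′
        j≡i′ = f-injective (trans fj≡ (sym (trans fi′≡ (φ-tail x))))
        j′≡i″ : j′ ≡ i″
        j′≡i″ = f-injective (trans fj′≡ (sym (trans fi″≡ (φ-tail (φ x)))))
        j″≡i : j″ ≡ i
        j″≡i = f-injective (trans fj″≡ (trans (sym (φ-tail (φ (φ x)))) (trans (cong tl e) (sym fi≡))))
        odd : ∀ p q r → p ≢ q → q ≢ r → r ≢ p → ⊥
        odd true  true  _     h _ _ = h refl
        odd false false _     h _ _ = h refl
        odd true  false true  _ _ h = h refl
        odd true  false false _ h _ = h refl
        odd false true  true  _ h _ = h refl
        odd false true  false _ _ h = h refl

      covers : ∀ {x} → T (B x) → ∃ λ i → tl x ≡ f i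
      covers Bx with B-sound Bx
      ... | i , _ , _ , e , _ = i , sym e

      α≢ : ∀ {x} → T (A x) → α x ≢ x
      α≢ {x} Ax e = α-free Ax (trans (sym (cong tl e)) (tl-arc _ _))

    -- This is e ≤ 3k - 6, as `pairs` counts every edge twice: faces have at least three darts. The
    -- inequality is decidable, which removes the double negation around the pruned map.
    girth3-bound : (∀ {i j} → T (b i j) → ∃ λ l → (T (b i l) × l ≢ j) ⊎ (T (b j l) × l ≢ i)) → pairs b + 12 ≤ 6 * k
    girth3-bound more = decidable-stable (_ ≤? _) λ k′ → pruned λ { (σ , rot , E , prunes) → k′ (bound rot E prunes) }
      where
      bound : ∀ {σ} → Rotates σ → Eulerian σ → (∀ d → Prunes σ d) → pairs b + 12 ≤ 6 * k
      bound {σ} rot E prunes = +-cancelʳ-≤ (2 * dartsB) _ _ (begin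
        pairs b + 12 + 2 * dartsB           ≤⟨ +-monoˡ-≤ (2 * dartsB) (+-monoˡ-≤ 12 pairs≤) ⟩
        dartsB + 12 + 2 * dartsB            ≡⟨ regroup₁ dartsB ⟩
        3 * (dartsB + 4)                    ≤⟨ *-monoʳ-≤ 3 euler-B ⟩
        3 * (2 * (k + fB))                  ≡⟨ regroup₂ k fB ⟩
        6 * k + 2 * (3 * fB)                ≤⟨ +-monoʳ-≤ (6 * k) (*-monoʳ-≤ 2 facesB) ⟩
        6 * k + 2 * dartsB                  ∎)
        where
        open Faces rot prunes
        girth : ∀ {x} → T (B x) → ∀ i → suc i < 3 → fold x φ (suc i) ≢ x
        girth Bx zero          _ = no-monogon Bx
        girth Bx (suc zero)    _ = no-digon more Bx
        girth Bx (suc (suc i)) (s≤s (s≤s (s≤s ())))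
        open Bound α-B α≢ edges-A f Fin._≟_ covers (B-arc (proj₂ (proj₂ nonempty))) rot E prunes 3 girth
        open ≤-Reasoning
        fB = count (onB? (Eulerian.face? E))
        regroup₁ : ∀ d → d + 12 + 2 * d ≡ 3 * (d + 4)
        regroup₁ = solve-∀
        regroup₂ : ∀ k f → 3 * (2 * (k + f)) ≡ 6 * k + 2 * (3 * f)
        regroup₂ = solve-∀

    -- This is e ≤ 2k - 4: the colouring raises the minimal face length to 4.
    bipartite-bound : (∀ {i j} → T (b i j) → ∃ λ l → (T (b i l) × l ≢ j) ⊎ (T (b j l) × l ≢ i)) →
      (c : Fin k → Bool) → (∀ {i j} → T (b i j) → c i ≢ c j) → pairs b + 8 ≤ 4 * k
    bipartite-bound more c proper = decidable-stable (_ ≤? _) λ k′ → pruned λ { (σ , rot , E , prunes) → k′ (bound rot E prunes) }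
      where
      bound : ∀ {σ} → Rotates σ → Eulerian σ → (∀ d → Prunes σ d) → pairs b + 8 ≤ 4 * k
      bound {σ} rot E prunes = +-cancelʳ-≤ dartsB _ _ (begin
        pairs b + 8 + dartsB                ≤⟨ +-monoˡ-≤ dartsB (+-monoˡ-≤ 8 pairs≤) ⟩
        dartsB + 8 + dartsB                 ≡⟨ regroup₁ dartsB ⟩
        2 * (dartsB + 4)                    ≤⟨ *-monoʳ-≤ 2 euler-B ⟩
        2 * (2 * (k + fB))                  ≡⟨ regroup₂ k fB ⟩
        4 * k + 4 * fB                      ≤⟨ +-monoʳ-≤ (4 * k) facesB ⟩
        4 * k + dartsB                      ∎)
        where
        open Faces rot prunes
        girth : ∀ {x} → T (B x) → ∀ i → suc i < 4 → fold x φ (suc i) ≢ x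
        girth Bx zero                _ = no-monogon Bx
        girth Bx (suc zero)          _ = no-digon more Bx
        girth Bx (suc (suc zero))    _ = no-triangle c proper Bx
        girth Bx (suc (suc (suc i))) (s≤s (s≤s (s≤s (s≤s ()))))
        open Bound α-B α≢ edges-A f Fin._≟_ covers (B-arc (proj₂ (proj₂ nonempty))) rot E prunes 4 girth
        open ≤-Reasoning
        fB = count (onB? (Eulerian.face? E))
        regroup₁ : ∀ d → d + 8 + d ≡ 2 * (d + 4)
        regroup₁ = solve-∀
        regroup₂ : ∀ k f → 2 * (2 * (k + f)) ≡ 4 * k + 4 * f
        regroup₂ = solve-∀

  -- Graphs on five vertices, and neighbourhoods in planar graphs

  all-vec? : ∀ {n} {P : Vec Bool n → Set} → (∀ v → Dec (P v)) → Dec (∀ v → P v)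
  all-vec? {zero}  P? = map′ (λ { p []ᵥ → p }) (λ h → h []ᵥ) (P? []ᵥ)
  all-vec? {suc n} P? = map′ (λ { (p , q) (true ∷ᵥ v) → p v ; (p , q) (false ∷ᵥ v) → q v })
    (λ h → (λ v → h (true ∷ᵥ v)) , λ v → h (false ∷ᵥ v))
    (all-vec? (λ v → P? (true ∷ᵥ v)) ×-dec all-vec? (λ v → P? (false ∷ᵥ v)))

  -- The graph on Fin 5 whose edges are listed by the entries above the diagonal of its adjacency matrix.
  matrix : Vec Bool 10 → Fin 5 → Fin 5 → Bool
  matrix (a ∷ᵥ b ∷ᵥ c ∷ᵥ d ∷ᵥ e ∷ᵥ f ∷ᵥ g ∷ᵥ h ∷ᵥ i ∷ᵥ j ∷ᵥ []ᵥ) x y = lookup (lookup rows x) y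
    where
    rows : Vec (Vec Bool 5) 5
    rows = (false ∷ᵥ a     ∷ᵥ b     ∷ᵥ c     ∷ᵥ d     ∷ᵥ []ᵥ)
         ∷ᵥ (a     ∷ᵥ false ∷ᵥ e     ∷ᵥ f     ∷ᵥ g     ∷ᵥ []ᵥ)
         ∷ᵥ (b     ∷ᵥ e     ∷ᵥ false ∷ᵥ h     ∷ᵥ i     ∷ᵥ []ᵥ)
         ∷ᵥ (c     ∷ᵥ f     ∷ᵥ h     ∷ᵥ false ∷ᵥ j     ∷ᵥ []ᵥ)
         ∷ᵥ (d     ∷ᵥ g     ∷ᵥ i     ∷ᵥ j     ∷ᵥ false ∷ᵥ []ᵥ)
         ∷ᵥ []ᵥ

  module _ (b : Fin 5 → Fin 5 → Bool) where

    valency : Fin 5 → ℕ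
    valency i = count λ j → T? (b i j)

    HasK₄ HasK₂₃ HasHub : Set
    HasK₄  = ∃ λ i → ∀ j k → j ≢ i → k ≢ i → j ≢ k → T (b j k)
    HasK₂₃ = ∃ λ i → ∃ λ j → i ≢ j × (∀ k → k ≢ i → k ≢ j → T (b i k) × T (b j k))
    HasHub = ∃ λ c → 4 ≤ valency c × (∀ i → valency i ≤ 2 → T (b c i))

    small? : ∀ i → Dec (valency i ≤ 2)
    small? i = valency i ≤? 2

    -- A maximal outerplanar graph on 5 vertices is a fan; its centre is the hub of the last case.
    Outerplanar₅ : Set
    Outerplanar₅ = HasK₄ ⊎ HasK₂₃ ⊎ (∃ λ i → valency i ≤ 1) ⊎ 3 ≤ count small? ⊎ (2 ≤ count small? × HasHub)

    outerplanar₅? : Dec Outerplanar₅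
    outerplanar₅? =
      (any? λ i → all? λ j → all? λ k → ¬? (j Fin.≟ i) →-dec (¬? (k Fin.≟ i) →-dec (¬? (j Fin.≟ k) →-dec T? (b j k))))
      ⊎-dec (any? λ i → any? λ j → ¬? (i Fin.≟ j) ×-dec all? λ k →
               ¬? (k Fin.≟ i) →-dec (¬? (k Fin.≟ j) →-dec (T? (b i k) ×-dec T? (b j k))))
      ⊎-dec any? (λ i → valency i ≤? 1)
      ⊎-dec 3 ≤? count small?
      ⊎-dec (2 ≤? count small? ×-dec any? λ c → 4 ≤? valency c ×-dec all? λ i → (valency i ≤? 2) →-dec T? (b c i))

  abstract
    -- Decided by evaluation over all 1024 graphs on five labelled vertices.
    outerplanar₅ : ∀ v → Outerplanar₅ (matrix v)
    outerplanar₅ = from-yes (all-vec? λ v → outerplanar₅? (matrix v))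

  ∷-injective : ∀ {A : Set} {k} {a : A} {f : Fin k → A} → (∀ i → f i ≢ a) → Injective f → Injective (a ∷ᶠ f)
  ∷-injective a∉ f-inj {zero}  {zero}  e = refl
  ∷-injective a∉ f-inj {zero}  {suc j} e = ⊥-elim (a∉ j (sym e))
  ∷-injective a∉ f-inj {suc i} {zero}  e = ⊥-elim (a∉ i e)
  ∷-injective a∉ f-inj {suc i} {suc j} e = cong suc (f-inj e)

  K₅ : Fin 5 → Fin 5 → Bool
  K₅ i j = not (does (i Fin.≟ j))

  side : Fin 6 → Bool
  side i = does (toℕ i <? 3)

  K₃₃ : Fin 6 → Fin 6 → Bool
  K₃₃ i j = side i xor side j

  module Planarity {n} {G : Graph n} (planar : Planar G) where
    open Graph G

    -- K₅ has 10 edges, where 3k - 6 allows 9.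
    no-K₅ : ∀ {f : Fin 5 → Fin n} → Injective f → ¬ (∀ {i j} → i ≢ j → f i ~ f j)
    no-K₅ {f} f-inj complete = from-yes (¬? (pairs K₅ + 12 ≤? 30))
      (girth3-bound λ {i} {j} p → more i j p)
      where
      edge : ∀ {i j} → T (K₅ i j) → f i ~ f j
      edge {i} {j} p with i Fin.≟ j
      ... | no i≢j = complete i≢j
      sym? : ∀ i j → Dec (T (K₅ i j) → T (K₅ j i))
      sym? i j = T? (K₅ i j) →-dec T? (K₅ j i)
      more : ∀ i j → T (K₅ i j) → ∃ λ l → (T (K₅ i l) × l ≢ j) ⊎ (T (K₅ j l) × l ≢ i)
      more = from-yes (all? λ i → all? λ j → T? (K₅ i j) →-dec any? λ l →
        (T? (K₅ i l) ×-dec ¬? (l Fin.≟ j)) ⊎-dec (T? (K₅ j l) ×-dec ¬? (l Fin.≟ i)))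
      open Pattern planar f f-inj K₅ (λ {i} {j} → from-yes (all? λ i → all? (sym? i)) i j) edge (zero , suc zero , tt)

    -- K₃,₃ has 9 edges, where 2k - 4 allows 8.
    no-K₃₃ : ∀ {f : Fin 6 → Fin n} → Injective f → ¬ (∀ i j → T (side i) → ¬ T (side j) → f i ~ f j)
    no-K₃₃ {f} f-inj complete = from-yes (¬? (pairs K₃₃ + 8 ≤? 24))
      (bipartite-bound (λ {i} {j} p → more i j p) side (λ {i} {j} p → proper i j p))
      where
      edge : ∀ {i j} → T (K₃₃ i j) → f i ~ f j
      edge {i} {j} p with side i in eq | side j in eq′
      ... | true  | false = complete i j (subst T (sym eq) tt) (subst T eq′)
      ... | false | true  = ~-sym (complete j i (subst T (sym eq′) tt) (subst T eq))
      sym? : ∀ i j → Dec (T (K₃₃ i j) → T (K₃₃ j i))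
      sym? i j = T? (K₃₃ i j) →-dec T? (K₃₃ j i)
      more : ∀ i j → T (K₃₃ i j) → ∃ λ l → (T (K₃₃ i l) × l ≢ j) ⊎ (T (K₃₃ j l) × l ≢ i)
      more = from-yes (all? λ i → all? λ j → T? (K₃₃ i j) →-dec any? λ l →
        (T? (K₃₃ i l) ×-dec ¬? (l Fin.≟ j)) ⊎-dec (T? (K₃₃ j l) ×-dec ¬? (l Fin.≟ i)))
      proper : ∀ i j → T (K₃₃ i j) → side i ≢ side j
      proper i j p e with side i | side j
      proper i j () refl | true  | _
      proper i j () refl | false | _
      open Pattern planar f f-inj K₃₃ (λ {i} {j} → from-yes (all? λ i → all? (sym? i)) i j) edge (zero , suc (suc (suc zero)) , tt)

    -- With at least two spokes, every edge meets another one: a spoke meets a second spoke at `v`,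
    -- and an edge between neighbours of `v` meets the spoke at its end.
    wheel-bound : ∀ {k v} (g : Fin (2 + k) → Fin n) → Injective g → (∀ i → v ~ g i) →
      pairs (λ i j → adj ((v ∷ᶠ g) i) ((v ∷ᶠ g) j)) + 12 ≤ 6 * (3 + k)
    wheel-bound {k} {v} g g-inj spoke = girth3-bound λ {i} {j} p → more i j p
      where
      f : Fin (3 + k) → Fin n
      f = v ∷ᶠ g
      g≢v : ∀ i → g i ≢ v
      g≢v i e = subst T (adj-irrefl v) (subst (v ~_) e (spoke i))
      other : ∀ (j : Fin (2 + k)) → ∃ λ l → l ≢ j
      other zero    = suc zero , λ ()
      other (suc j) = zero , λ ()
      more : ∀ i j → f i ~ f j → ∃ λ l → (f i ~ f l × l ≢ j) ⊎ (f j ~ f l × l ≢ i)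
      more zero    zero    p = ⊥-elim (subst T (adj-irrefl v) p)
      more zero    (suc j) p = let l , l≢j = other j in suc l , inj₁ (spoke l , l≢j ∘ Fin.suc-injective)
      more (suc i) zero    p = let l , l≢i = other i in suc l , inj₂ (spoke l , l≢i ∘ Fin.suc-injective)
      more (suc i) (suc j) p = zero , inj₁ (~-sym (spoke i) , λ ())
      open Pattern planar f (∷-injective g≢v g-inj) (λ i j → adj (f i) (f j)) ~-sym id (zero , suc zero , spoke zero)

    module Neighbourhood₅ {v} (g : Fin 5 → Fin n) (g-inj : Injective g) (spoke : ∀ i → v ~ g i) where

      private
        e : Fin 5 → Fin 5 → Bool
        e i j = adj (g i) (g j)

        0F 1F 2F 3F 4F : Fin 5
        0F = zero
        1F = suc zero
        2F = suc (suc zero)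
        3F = suc (suc (suc zero))
        4F = suc (suc (suc (suc zero)))

      entries : Vec Bool 10
      entries = e 0F 1F ∷ᵥ e 0F 2F ∷ᵥ e 0F 3F ∷ᵥ e 0F 4F ∷ᵥ e 1F 2F ∷ᵥ e 1F 3F ∷ᵥ e 1F 4F ∷ᵥ e 2F 3F ∷ᵥ e 2F 4F ∷ᵥ e 3F 4F ∷ᵥ []ᵥ

      M : Fin 5 → Fin 5 → Bool
      M = matrix entries

      -- Lets the exhaustive check, which speaks about listed matrix entries, apply to the adjacency
      -- among the neighbours of `v`.
      M-adj : ∀ i j → M i j ≡ adj (g i) (g j)
      M-adj zero zero = sym (adj-irrefl _)
      M-adj zero (suc zero) = refl
      M-adj zero (suc (suc zero)) = refl
      M-adj zero (suc (suc (suc zero))) = refl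
      M-adj zero (suc (suc (suc (suc zero)))) = refl
      M-adj (suc zero) zero = adj-sym _ _
      M-adj (suc zero) (suc zero) = sym (adj-irrefl _)
      M-adj (suc zero) (suc (suc zero)) = refl
      M-adj (suc zero) (suc (suc (suc zero))) = refl
      M-adj (suc zero) (suc (suc (suc (suc zero)))) = refl
      M-adj (suc (suc zero)) zero = adj-sym _ _
      M-adj (suc (suc zero)) (suc zero) = adj-sym _ _
      M-adj (suc (suc zero)) (suc (suc zero)) = sym (adj-irrefl _)
      M-adj (suc (suc zero)) (suc (suc (suc zero))) = refl
      M-adj (suc (suc zero)) (suc (suc (suc (suc zero)))) = refl
      M-adj (suc (suc (suc zero))) zero = adj-sym _ _
      M-adj (suc (suc (suc zero))) (suc zero) = adj-sym _ _
      M-adj (suc (suc (suc zero))) (suc (suc zero)) = adj-sym _ _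
      M-adj (suc (suc (suc zero))) (suc (suc (suc zero))) = sym (adj-irrefl _)
      M-adj (suc (suc (suc zero))) (suc (suc (suc (suc zero)))) = refl
      M-adj (suc (suc (suc (suc zero)))) zero = adj-sym _ _
      M-adj (suc (suc (suc (suc zero)))) (suc zero) = adj-sym _ _
      M-adj (suc (suc (suc (suc zero)))) (suc (suc zero)) = adj-sym _ _
      M-adj (suc (suc (suc (suc zero)))) (suc (suc (suc zero))) = adj-sym _ _
      M-adj (suc (suc (suc (suc zero)))) (suc (suc (suc (suc zero)))) = sym (adj-irrefl _)

      g≢v : ∀ i → g i ≢ v
      g≢v i e = subst T (adj-irrefl v) (subst (v ~_) e (spoke i))

      M-~ : ∀ {i j} → T (M i j) → g i ~ g j
      M-~ {i} {j} = subst T (M-adj i j)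

      no-K₄ : ¬ HasK₄ M
      no-K₄ (i , complete) = no-K₅ {v ∷ᶠ (g ∘ punchIn i)} (∷-injective (g≢v ∘ punchIn i) (Fin.punchIn-injective i _ _ ∘ g-inj)) edge
        where
        edge : ∀ {j k} → j ≢ k → (v ∷ᶠ (g ∘ punchIn i)) j ~ (v ∷ᶠ (g ∘ punchIn i)) k
        edge {zero}  {zero}  j≢k = ⊥-elim (j≢k refl)
        edge {zero}  {suc k} _   = spoke _
        edge {suc j} {zero}  _   = ~-sym (spoke _)
        edge {suc j} {suc k} j≢k = M-~ (complete _ _ (Fin.punchInᵢ≢i i j) (Fin.punchInᵢ≢i i k)
          λ e → j≢k (cong suc (Fin.punchIn-injective i j k e)))

      -- `v` joins `i` and `j` as the third vertex on their side of a K₃,₃.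
      no-K₂₃ : ¬ HasK₂₃ M
      no-K₂₃ (i , j , i≢j , complete) = no-K₃₃ {f} f-inj edge
        where
        j′ : Fin 4
        j′ = punchOut i≢j
        h : Fin 3 → Fin 5
        h p = punchIn i (punchIn j′ p)
        h≢i : ∀ p → h p ≢ i
        h≢i p = Fin.punchInᵢ≢i i (punchIn j′ p)
        h≢j : ∀ p → h p ≢ j
        h≢j p e = Fin.punchInᵢ≢i j′ p (Fin.punchIn-injective i _ _ (trans e (sym (Fin.punchIn-punchOut i≢j))))
        f : Fin 6 → Fin n
        f = v ∷ᶠ (g i ∷ᶠ (g j ∷ᶠ (g ∘ h)))
        f-inj : Injective f
        f-inj = ∷-injective (λ { zero → g≢v i ; (suc zero) → g≢v j ; (suc (suc p)) → g≢v (h p) })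
          (∷-injective (λ { zero e → i≢j (sym (g-inj e)) ; (suc p) e → h≢i p (g-inj e) })
          (∷-injective (λ p e → h≢j p (g-inj e))
            (λ e → Fin.punchIn-injective j′ _ _ (Fin.punchIn-injective i _ _ (g-inj e)))))
        edge : ∀ p q → T (side p) → ¬ T (side q) → f p ~ f q
        edge p zero _ ¬q = ⊥-elim (¬q tt)
        edge p (suc zero) _ ¬q = ⊥-elim (¬q tt)
        edge p (suc (suc zero)) _ ¬q = ⊥-elim (¬q tt)
        edge zero (suc (suc (suc q))) _ _ = spoke (h q)
        edge (suc zero) (suc (suc (suc q))) _ _ = M-~ (proj₁ (complete (h q) (h≢i q) (h≢j q)))
        edge (suc (suc zero)) (suc (suc (suc q))) _ _ = M-~ (proj₂ (complete (h q) (h≢i q) (h≢j q)))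

      shape : (∃ λ i → valency M i ≤ 1) ⊎ 3 ≤ count (small? M) ⊎ (2 ≤ count (small? M) × HasHub M)
      shape with outerplanar₅ entries
      ... | inj₁ k₄ = ⊥-elim (no-K₄ k₄)
      ... | inj₂ (inj₁ k₂₃) = ⊥-elim (no-K₂₃ k₂₃)
      ... | inj₂ (inj₂ s) = s

  -- Planar graphs without S₂,₄

  -- The edges of S₂,₄, each in one direction, in a form that can be matched on; `doubleStar` only
  -- computes them as Booleans.
  data Arm : Fin 8 → Fin 8 → Set where
    backbone : Arm zero (suc zero)
    left₁    : Arm zero (suc (suc zero))
    left₂    : Arm zero (suc (suc (suc zero)))
    right    : ∀ i → Arm (suc zero) (suc (suc (suc (suc i))))

  arm? : ∀ u w → Dec (Arm u w)
  arm? zero zero = no λ ()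
  arm? zero (suc zero) = yes backbone
  arm? zero (suc (suc zero)) = yes left₁
  arm? zero (suc (suc (suc zero))) = yes left₂
  arm? zero (suc (suc (suc (suc _)))) = no λ ()
  arm? (suc zero) zero = no λ ()
  arm? (suc zero) (suc zero) = no λ ()
  arm? (suc zero) (suc (suc zero)) = no λ ()
  arm? (suc zero) (suc (suc (suc zero))) = no λ ()
  arm? (suc zero) (suc (suc (suc (suc i)))) = yes (right i)
  arm? (suc (suc _)) _ = no λ ()
  abstract
    arms : ∀ u w → T (Graph.adj (doubleStar 2 4) u w) → Arm u w ⊎ Arm w u
    arms = from-yes (all? λ u → all? λ w → T? (Graph.adj (doubleStar 2 4) u w) →-dec (arm? u w ⊎-dec arm? w u))

  module Main {n} {G : Graph n} (planar : Planar G) (free : ¬ Contains (doubleStar 2 4) G) where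
    open Graph G
    open Planarity planar

    ~-irrefl : ∀ {v} → ¬ (v ~ v)
    ~-irrefl {v} = subst T (adj-irrefl v)

    ~⇒≢ : ∀ {u v} → u ~ v → u ≢ v
    ~⇒≢ u~v refl = ~-irrefl u~v

    no-star : ∀ {v x y₁ y₂} → v ~ x → x ~ y₁ → x ~ y₂ → y₁ ≢ y₂ → y₁ ≢ v → y₂ ≢ v →
      ∀ {z : Fin 4 → Fin n} → Injective z → (∀ i → v ~ z i) → (∀ i → z i ≢ x) → (∀ i → z i ≢ y₁) → (∀ i → z i ≢ y₂) → ⊥
    no-star {v} {x} {y₁} {y₂} v~x x~y₁ x~y₂ y₁≢y₂ y₁≢v y₂≢v {z} z-inj v~z z≢x z≢y₁ z≢y₂ = free (f , f-inj , edges)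
      where
      f : Fin 8 → Fin n
      f = x ∷ᶠ (v ∷ᶠ (y₁ ∷ᶠ (y₂ ∷ᶠ z)))
      f-inj : Injective f
      f-inj = ∷-injective (λ { zero → ~⇒≢ v~x ; (suc zero) → ~⇒≢ x~y₁ ∘ sym ; (suc (suc zero)) → ~⇒≢ x~y₂ ∘ sym ; (suc (suc (suc i))) → z≢x i })
        (∷-injective (λ { zero → y₁≢v ; (suc zero) → y₂≢v ; (suc (suc i)) → ~⇒≢ (v~z i) ∘ sym })
        (∷-injective (λ { zero → y₁≢y₂ ∘ sym ; (suc i) → z≢y₁ i })
        (∷-injective z≢y₂ z-inj)))
      arm : ∀ {u w} → Arm u w → f u ~ f w
      arm backbone  = ~-sym v~x
      arm left₁     = x~y₁
      arm left₂     = x~y₂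
      arm (right i) = v~z i
      edges : ∀ u w → T (Graph.adj (doubleStar 2 4) u w) → f u ~ f w
      edges u w p = Sum.[ arm , ~-sym ∘ arm ] (arms u w p)

    -- `S` is the set of vertices not yet deleted. Degrees and arcs are counted within it, and an
    -- arc is an edge with a direction.
    module Within (S : Fin n → Bool) where

      N : Fin n → Fin n → Set
      N u v = T (S v) × u ~ v

      N? : ∀ u v → Dec (N u v)
      N? u v = T? (S v) ×-dec T? (adj u v)

      deg : Fin n → ℕ
      deg u = count (N? u)

      arc? : ∀ u v → Dec (T (S u) × N u v)
      arc? u v = T? (S u) ×-dec N? u v

      size arcs : ℕ
      size = count λ u → T? (S u)
      arcs = sum λ u → count (arc? u)

      -- Freeness in numerical form, and the only way in which it is used from here on. With
      -- backbone `v`, `x` and leaves `y₁`, `y₂` at `x`, at most three neighbours of `v` can avoid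
      -- `x`, `y₁` and `y₂`.
      deg-bound : ∀ {v x y₁ y₂} → v ~ x → x ~ y₁ → x ~ y₂ → y₁ ≢ y₂ → y₁ ≢ v → y₂ ≢ v →
        deg v ≤ 4 + (𝟙 (T? (adj v y₁)) + 𝟙 (T? (adj v y₂)))
      deg-bound {v} {x} {y₁} {y₂} v~x x~y₁ x~y₂ y₁≢y₂ y₁≢v y₂≢v = begin
        deg v                           ≤⟨ count-cover (N? v) Z? X∪Y? splitZ ⟩
        count Z? + count X∪Y?           ≤⟨ +-mono-≤ few (count-cover X∪Y? (x Fin.≟_) Y? id) ⟩
        3 + (count (x Fin.≟_) + count Y?) ≤⟨ +-monoʳ-≤ 3 (+-mono-≤ (≤-reflexive (count-≟ x)) (count-cover Y? (Yᵢ? y₁) (Yᵢ? y₂) id)) ⟩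
        4 + (count (Yᵢ? y₁) + count (Yᵢ? y₂)) ≤⟨ +-monoʳ-≤ 4 (+-mono-≤ (count-point y₁ (T? (adj v y₁))) (count-point y₂ (T? (adj v y₂)))) ⟩
        4 + (𝟙 (T? (adj v y₁)) + 𝟙 (T? (adj v y₂))) ∎
        where
        open ≤-Reasoning
        Z? : ∀ z → Dec (N v z × z ≢ x × z ≢ y₁ × z ≢ y₂)
        Z? z = N? v z ×-dec (¬? (z Fin.≟ x) ×-dec (¬? (z Fin.≟ y₁) ×-dec ¬? (z Fin.≟ y₂)))
        Yᵢ? : ∀ y z → Dec (y ≡ z × v ~ y)
        Yᵢ? y z = (y Fin.≟ z) ×-dec T? (adj v y)
        Y? : ∀ z → Dec ((y₁ ≡ z × v ~ y₁) ⊎ (y₂ ≡ z × v ~ y₂))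
        Y? z = Yᵢ? y₁ z ⊎-dec Yᵢ? y₂ z
        X∪Y? : ∀ z → Dec (x ≡ z ⊎ ((y₁ ≡ z × v ~ y₁) ⊎ (y₂ ≡ z × v ~ y₂)))
        X∪Y? z = (x Fin.≟ z) ⊎-dec Y? z
        splitZ : ∀ {z} → N v z → (N v z × z ≢ x × z ≢ y₁ × z ≢ y₂) ⊎ (x ≡ z ⊎ ((y₁ ≡ z × v ~ y₁) ⊎ (y₂ ≡ z × v ~ y₂)))
        splitZ {z} nz with z Fin.≟ x | z Fin.≟ y₁ | z Fin.≟ y₂
        ... | yes refl | _        | _        = inj₂ (inj₁ refl)
        ... | no _     | yes refl | _        = inj₂ (inj₂ (inj₁ (refl , proj₂ nz)))
        ... | no _     | no _     | yes refl = inj₂ (inj₂ (inj₂ (refl , proj₂ nz)))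
        ... | no a     | no b     | no c     = inj₁ (nz , a , b , c)
        few : count Z? ≤ 3
        few with 4 ≤? count Z?
        ... | no ¬4 = s≤s⁻¹ (≰⇒> ¬4)
        ... | yes 4≤ with enumerate Z?
        ...   | g , g-inj , sat , _ = ⊥-elim (no-star v~x x~y₁ x~y₂ y₁≢y₂ y₁≢v y₂≢v
                {λ i → g (inject≤ i 4≤)} (λ e → Fin.inject≤-injective 4≤ 4≤ _ _ (g-inj e))
                (λ i → proj₂ (proj₁ (sat (inject≤ i 4≤)))) (λ i → proj₁ (proj₂ (sat (inject≤ i 4≤))))
                (λ i → proj₁ (proj₂ (proj₂ (sat (inject≤ i 4≤))))) (λ i → proj₂ (proj₂ (proj₂ (sat (inject≤ i 4≤))))))

    open Within

    -- Says without subtraction that 5 · arcs - 23 · size does not decrease from `S` to `S′`, so the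
    -- bound for `S′` implies that for `S`.
    Reducible : (Fin n → Bool) → Set
    Reducible S = ∃ λ S′ → size S′ < size S × 5 * arcs S + 23 * size S′ ≤ 5 * arcs S′ + 23 * size S

    module _ (S : Fin n → Bool) {C : Fin n → Set} (C? : ∀ u → Dec (C u)) (C⊆S : ∀ {u} → C u → T (S u)) where

      touch? : ∀ u v → Dec ((T (S u) × N S u v) × (C u ⊎ C v))
      touch? u v = arc? S u v ×-dec (C? u ⊎-dec C? v)

      -- A set meeting at most 23/5 arcs per vertex can go. Both directions of an edge count in `e`.
      remove : ∀ {e c} → (sum λ u → count (touch? u)) ≤ e → c ≤ count C? → 5 * e ≤ 23 * c → 1 ≤ c → Reducible S
      remove {e} {c} E≤e c≤ 5e≤23c 1≤c = S′ , <-≤-trans (m<m+n _ 1≤c) shrinks , (begin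
        5 * arcs S + 23 * size S′           ≤⟨ +-monoˡ-≤ (23 * size S′) (*-monoʳ-≤ 5 loses) ⟩
        5 * (arcs S′ + e) + 23 * size S′    ≡⟨ regroup₁ (arcs S′) e (size S′) ⟩
        5 * arcs S′ + 23 * size S′ + 5 * e  ≤⟨ +-monoʳ-≤ (5 * arcs S′ + 23 * size S′) 5e≤23c ⟩
        5 * arcs S′ + 23 * size S′ + 23 * c ≡⟨ regroup₂ (5 * arcs S′) (size S′) c ⟩
        5 * arcs S′ + 23 * (size S′ + c)    ≤⟨ +-monoʳ-≤ (5 * arcs S′) (*-monoʳ-≤ 23 shrinks) ⟩
        5 * arcs S′ + 23 * size S           ∎)
        where
        open ≤-Reasoning
        left? : ∀ u → Dec (T (S u) × ¬ C u)
        left? u = T? (S u) ×-dec ¬? (C? u)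
        S′ : Fin n → Bool
        S′ u = does (left? u)
        regroup₁ : ∀ a e s → 5 * (a + e) + 23 * s ≡ 5 * a + 23 * s + 5 * e
        regroup₁ = solve-∀
        regroup₂ : ∀ a s c → a + 23 * s + 23 * c ≡ a + 23 * (s + c)
        regroup₂ = solve-∀
        shrinks : size S′ + c ≤ size S
        shrinks = ≤-trans (+-monoʳ-≤ (size S′) c≤) (count-disjoint (λ u → T? (S′ u)) C? (λ u → T? (S u))
          (λ {u} p → proj₁ (does-sound (left? u) p)) C⊆S (λ {u} p → proj₂ (does-sound (left? u) p)))
        split : ∀ u v → T (S u) × N S u v → (T (S′ u) × N S′ u v) ⊎ ((T (S u) × N S u v) × (C u ⊎ C v))
        split u v p@(Su , Sv , u~v) = by (C? u) (C? v)
          where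
          by : Dec (C u) → Dec (C v) → (T (S′ u) × N S′ u v) ⊎ ((T (S u) × N S u v) × (C u ⊎ C v))
          by (yes c) _       = inj₂ (p , inj₁ c)
          by (no _)  (yes c) = inj₂ (p , inj₂ c)
          by (no ¬c) (no ¬d) = inj₁ (does-complete (left? u) (Su , ¬c) , does-complete (left? v) (Sv , ¬d) , u~v)
        loses : arcs S ≤ arcs S′ + e
        loses = begin
          arcs S ≤⟨ sum-mono (λ u → count-cover (arc? S u) (arc? S′ u) (touch? u) (λ {v} → split u v)) ⟩
          (sum λ u → count (arc? S′ u) + count (touch? u)) ≡⟨ ∑-distrib-+ (λ u → count (arc? S′ u)) (λ u → count (touch? u)) ⟩
          arcs S′ + (sum λ u → count (touch? u)) ≤⟨ +-monoʳ-≤ (arcs S′) E≤e ⟩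
          arcs S′ + e ∎

    remove-small : ∀ S {c} → T (S c) → deg S c ≤ 2 → Reducible S
    remove-small S {c} Sc deg≤2 = remove S (c Fin.≟_) c⊆S {e = 4} {c = 1}
      (begin
        (sum λ u → count (touch? S (c Fin.≟_) c⊆S u))
          ≤⟨ sum-mono (λ u → count-cover (touch? S (c Fin.≟_) c⊆S u) (out? u) (in? u) (split u)) ⟩
        (sum λ u → count (out? u) + count (in? u)) ≡⟨ ∑-distrib-+ (λ u → count (out? u)) (λ u → count (in? u)) ⟩
        (sum λ u → count (out? u)) + (sum λ u → count (in? u)) ≡⟨ cong (_+ (sum λ u → count (in? u))) (∑-comm (λ u v → 𝟙 (out? u v))) ⟩
        (sum λ v → count (λ u → out? u v)) + (sum λ u → count (in? u))
          ≤⟨ +-mono-≤ (sum-mono λ v → count-point c (N? S c v)) (sum-mono λ u → count-point c (N? S c u)) ⟩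
        deg S c + deg S c ≤⟨ +-mono-≤ deg≤2 deg≤2 ⟩
        4 ∎)
      (≤-reflexive (sym (count-≟ c))) (from-yes (20 ≤? 23)) ≤-refl
      where
      open ≤-Reasoning
      c⊆S : ∀ {u} → c ≡ u → T (S u)
      c⊆S refl = Sc
      out? : ∀ u v → Dec (c ≡ u × N S c v)
      out? u v = (c Fin.≟ u) ×-dec N? S c v
      in? : ∀ u v → Dec (c ≡ v × N S c u)
      in? u v = (c Fin.≟ v) ×-dec N? S c u
      split : ∀ u {v} → (T (S u) × N S u v) × (c ≡ u ⊎ c ≡ v) → (c ≡ u × N S c v) ⊎ (c ≡ v × N S c u)
      split u (( _ , nv) , inj₁ refl) = inj₁ (refl , nv)
      split u ((Su , _ , u~v) , inj₂ refl) = inj₂ (refl , Su , ~-sym u~v)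

    module _ (S : Fin n → Bool) {v} (Sv : T (S v)) (g : Fin 6 → Fin n) (g-inj : Injective g)
      (g-N : ∀ i → N S v (g i)) (onto : ∀ {x} → N S v x → ∃ λ i → g i ≡ x)
      (closed : ∀ {x y} → N S v x → x ~ y → y ≢ v → v ~ y) where

      private
        open ≤-Reasoning
        f : Fin 7 → Fin n
        f = v ∷ᶠ g
        f-inj : Injective f
        f-inj = ∷-injective (λ i e → ~⇒≢ (proj₂ (g-N i)) (sym e)) g-inj
        C : Fin n → Set
        C u = ∃ λ i → f i ≡ u
        C? : ∀ u → Dec (C u)
        C? u = any? λ i → f i Fin.≟ u
        C⊆S : ∀ {u} → C u → T (S u)
        C⊆S (zero  , refl) = Sv
        C⊆S (suc i , refl) = proj₁ (g-N i)
        C-sum : ∀ F → (sum λ u → 𝟙 (C? u) * F u) ≡ sum (F ∘ f)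
        C-sum F = sum-image f F C? f-inj (λ i → i , refl) id
        C-size : count C? ≡ 7
        C-size = trans (sum-cong-≗ (λ u → sym (*-identityʳ (𝟙 (C? u))))) (C-sum (λ _ → 1))
        C-closed : ∀ {u w} → C u → N S u w → C w
        C-closed (zero , refl) nw = let i , e = onto nw in suc i , e
        C-closed {w = w} (suc i , refl) (Sw , u~w) with w Fin.≟ v
        ... | yes refl = zero , refl
        ... | no w≢v = C-closed (zero , refl) (Sw , closed (g-N i) u~w w≢v)
        -- As `C` is closed under adjacency within `S`, an arc that touches `C` has both ends in
        -- `C`.
        both : ∀ u w → 𝟙 (touch? S C? C⊆S u w) ≤ 𝟙 (C? u) * (𝟙 (C? w) * 𝟙 (T? (adj u w)))
        both u w = ≤-trans (𝟙-mono (touch? S C? C⊆S u w) (C? u ×-dec (C? w ×-dec T? (adj u w))) split)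
          (≤-reflexive (trans (𝟙-× (C? u) (C? w ×-dec T? (adj u w))) (cong (𝟙 (C? u) *_) (𝟙-× (C? w) (T? (adj u w))))))
          where
          split : (T (S u) × N S u w) × (C u ⊎ C w) → C u × C w × u ~ w
          split ((_ , nw) , inj₁ c)        = c , C-closed c nw , proj₂ nw
          split ((Su , Sw , u~w) , inj₂ c) = C-closed c (Su , ~-sym u~w) , c , u~w
        edges≤15 : pairs (λ i j → adj (f i) (f j)) ≤ 30
        edges≤15 = +-cancelʳ-≤ 12 (pairs λ i j → adj (f i) (f j)) 30 (wheel-bound {4} {v} g g-inj (proj₂ ∘ g-N))
        inside : (sum λ u → count (touch? S C? C⊆S u)) ≤ 30
        inside = begin
          (sum λ u → count (touch? S C? C⊆S u)) ≤⟨ sum-mono (λ u → sum-mono (both u)) ⟩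
          (sum λ u → sum λ w → 𝟙 (C? u) * (𝟙 (C? w) * 𝟙 (T? (adj u w))))
            ≡⟨ sum-cong-≗ (λ u → sym (*-distribˡ-sum (𝟙 (C? u)) (λ w → 𝟙 (C? w) * 𝟙 (T? (adj u w))))) ⟩
          (sum λ u → 𝟙 (C? u) * (sum λ w → 𝟙 (C? w) * 𝟙 (T? (adj u w)))) ≡⟨ C-sum (λ u → sum λ w → 𝟙 (C? w) * 𝟙 (T? (adj u w))) ⟩
          (sum λ i → sum λ w → 𝟙 (C? w) * 𝟙 (T? (adj (f i) w))) ≡⟨ sum-cong-≗ (λ i → C-sum (λ w → 𝟙 (T? (adj (f i) w)))) ⟩
          pairs (λ i j → adj (f i) (f j)) ≤⟨ edges≤15 ⟩
          30 ∎

      remove-component : Reducible S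
      remove-component = remove S C? C⊆S {e = 30} {c = 7} inside
        (≤-reflexive (sym C-size)) (from-yes (150 ≤? 161)) (s≤s z≤n)

    -- By freeness, a vertex of degree at least 6 together with its neighbours is a component on 7 vertices.
    remove-large : ∀ S {v} → T (S v) → (∀ {u} → T (S u) → 3 ≤ deg S u) → 6 ≤ deg S v → Reducible S
    remove-large S {v} Sv min 6≤ = component deg≡6
      where
      twice : ∀ {x y₁ y₂} → N S v x → x ~ y₁ → x ~ y₂ → y₁ ≢ y₂ → y₁ ≢ v → y₂ ≢ v → deg S v ≤ 6 × v ~ y₁
      twice {x} {y₁} {y₂} (_ , v~x) x~y₁ x~y₂ y₁≢y₂ y₁≢v y₂≢v
        -- A degree of at least 6 must fit under 4 plus the two indicators, so both `y₁` and `y₂`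
        -- are adjacent to `v` and the degree is at most 6.
        with adj v y₁ | adj v y₂ | deg-bound S v~x x~y₁ x~y₂ y₁≢y₂ y₁≢v y₂≢v
      ... | true  | true  | b = b , tt
      ... | true  | false | b = ⊥-elim (<⇒≱ (s≤s b) 6≤)
      ... | false | true  | b = ⊥-elim (<⇒≱ (s≤s b) 6≤)
      ... | false | false | b = ⊥-elim (<⇒≱ (s≤s (≤-trans b (n≤1+n 4))) 6≤)
      closed : ∀ {x y} → N S v x → x ~ y → y ≢ v → deg S v ≤ 6 × v ~ y
      -- Minimum degree 3 gives `x` a neighbour besides `v` and `y`, the second leaf that freeness
      -- needs.
      closed {x} {y} nx x~y y≢v with third (N? S x) (min (proj₁ nx)) v y
      ... | y′ , (_ , x~y′) , y′≢v , y′≢y = twice nx x~y x~y′ (y′≢y ∘ sym) y≢v y′≢v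
      component : deg S v ≡ 6 → Reducible S
      component deg≡6 =
        let g , g-inj , g-N , onto = enumerate-as (N? S v) deg≡6 in
        remove-component S Sv g g-inj g-N onto λ nx x~y y≢v → proj₂ (closed nx x~y y≢v)
      deg≡6 : deg S v ≡ 6
      deg≡6 with third (N? S v) (min Sv) v v
      ... | x , nx , _ with third (N? S x) (min (proj₁ nx)) v v
      ...   | y , (_ , x~y) , y≢v , _ = ≤-antisym (proj₁ (closed nx x~y y≢v)) 6≤

  -- Discharging when all degrees are at most 5

  module Discharge {n} {G : Graph n} (planar : Planar G) (free : ¬ Contains (doubleStar 2 4) G) (S : Fin n → Bool)
    (max : ∀ {u} → T (S u) → Main.Within.deg planar free S u ≤ 5) where
    open Graph G
    open Planarity planar
    open Main planar free
    open Within S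

    Low High : Fin n → Set
    Low u  = T (S u) × deg u ≤ 4
    High u = T (S u) × 5 ≤ deg u

    low? : ∀ u → Dec (Low u)
    low? u = T? (S u) ×-dec (deg u ≤? 4)

    high? : ∀ u → Dec (High u)
    high? u = T? (S u) ×-dec (5 ≤? deg u)

    highNeighbour? : ∀ x y → Dec (High y × x ~ y)
    highNeighbour? x y = high? y ×-dec T? (adj x y)

    #high : Fin n → ℕ
    #high x = count (highNeighbour? x)

    -- At scale 20 the allowed average 23/5 becomes 92, so a vertex of degree 5 is over by 8. A
    -- vertex of degree 4 can spare 12, which is 3 for each of four takers or 4 for each of at most
    -- three. A vertex of degree at most 3 can spare at least 32, enough for 8 to each of at most
    -- three.
    amount : ∀ {P Q : Set} → Dec P → Dec Q → ℕ
    amount (yes _) _       = 8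
    amount (no _)  (yes _) = 3
    amount (no _)  (no _)  = 4

    -- What a vertex of low degree hands to each of its neighbours of degree 5.
    give : Fin n → ℕ
    give x = amount (deg x ≤? 3) (4 ≤? #high x)

    3≤give : ∀ x → 3 ≤ give x
    3≤give x with deg x ≤? 3 | 4 ≤? #high x
    ... | yes _ | _     = from-yes (3 ≤? 8)
    ... | no _  | yes _ = from-yes (3 ≤? 3)
    ... | no _  | no _  = from-yes (3 ≤? 4)

    4≤give : ∀ {x} → #high x ≤ 3 → 4 ≤ give x
    4≤give {x} ≤3 with deg x ≤? 3 | 4 ≤? #high x
    ... | yes _ | _      = from-yes (4 ≤? 8)
    ... | no _  | yes 4≤ = ⊥-elim (<⇒≱ 4≤ ≤3)
    ... | no _  | no _   = ≤-refl

    8≤give : ∀ {x} → deg x ≤ 3 → 8 ≤ give x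
    8≤give {x} ≤3 with deg x ≤? 3
    ... | yes _ = ≤-refl
    ... | no ¬≤ = ⊥-elim (¬≤ ≤3)

    #high≤deg : ∀ x → #high x ≤ deg x
    #high≤deg x = count-mono (highNeighbour? x) (N? x) λ { ((Sy , _) , x~y) → Sy , x~y }

    give-cap : ∀ {x} → deg x ≤ 4 → 20 * deg x + #high x * give x ≤ 92
    give-cap {x} deg≤4 with deg x ≤? 3 | 4 ≤? #high x
    ... | yes ≤3 | _      = ≤-trans (+-mono-≤ (*-monoʳ-≤ 20 ≤3) (*-monoˡ-≤ 8 (≤-trans (#high≤deg x) ≤3))) (from-yes (84 ≤? 92))
    ... | no _   | yes _  = +-mono-≤ (*-monoʳ-≤ 20 deg≤4) (*-monoˡ-≤ 3 (≤-trans (#high≤deg x) deg≤4))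
    ... | no _   | no ¬4≤ = +-mono-≤ (*-monoʳ-≤ 20 deg≤4) (*-monoˡ-≤ 4 (s≤s⁻¹ (≰⇒> ¬4≤)))

    lowNeighbour? : ∀ v x → Dec (N v x × Low x)
    lowNeighbour? v x = N? v x ×-dec low? x

    received out : Fin n → ℕ
    received v = sum λ x → 𝟙 (lowNeighbour? v x) * give x
    out x = #high x * (𝟙 (low? x) * give x)

    module AtHigh {v} (Hv : High v) (g : Fin 5 → Fin n) (g-inj : Injective g)
      (g-N : ∀ i → N v (g i)) (onto : ∀ {x} → N v x → ∃ λ i → g i ≡ x) where
      open Neighbourhood₅ g g-inj (proj₂ ∘ g-N)

      N-sum : ∀ F → (sum λ x → 𝟙 (N? v x) * F x) ≡ sum (F ∘ g)
      N-sum F = sum-image g F (N? v) g-inj g-N onto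

      received-sum : received v ≡ sum λ i → 𝟙 (low? (g i)) * give (g i)
      received-sum = trans (sum-cong-≗ λ x → trans (cong (_* give x) (𝟙-× (N? v x) (low? x))) (*-assoc (𝟙 (N? v x)) _ _))
                           (N-sum λ x → 𝟙 (low? x) * give x)

      common? : ∀ x y → Dec (N v y × x ~ y)
      common? x y = N? v y ×-dec T? (adj x y)

      codegree : ∀ i → count (common? (g i)) ≡ valency M i
      codegree i = trans (sum-cong-≗ λ y → 𝟙-× (N? v y) (T? (adj (g i) y)))
        (trans (N-sum λ y → 𝟙 (T? (adj (g i) y))) (sum-cong-≗ λ j → cong (λ b → 𝟙 (T? b)) (sym (M-adj i j))))

      outside? : ∀ x y → Dec (N x y × v ≢ y × ¬ v ~ y)
      outside? x y = N? x y ×-dec (¬? (v Fin.≟ y) ×-dec ¬? (T? (adj v y)))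

      -- Two neighbours of `g i` outside N[v] would be leaves not adjacent to `v`, and `deg-bound`
      -- would leave `v` with degree at most 4.
      outside≤1 : ∀ i → count (outside? (g i)) ≤ 1
      outside≤1 i = count-unique (outside? (g i)) unique
        where
        unique : ∀ {y y′} → N (g i) y × v ≢ y × ¬ v ~ y → N (g i) y′ × v ≢ y′ × ¬ v ~ y′ → y ≡ y′
        unique {y} {y′} ((_ , x~y) , v≢y , v≁y) ((_ , x~y′) , v≢y′ , v≁y′) with y Fin.≟ y′
        ... | yes e = e
        ... | no y≢y′ = ⊥-elim (<⇒≱ (s≤s (deg-bound (proj₂ (g-N i)) x~y x~y′ y≢y′ (v≢y ∘ sym) (v≢y′ ∘ sym)))
          (subst (λ k → suc (4 + k) ≤ deg v) (sym (cong₂ _+_ (𝟙-no (T? (adj v y)) v≁y) (𝟙-no (T? (adj v y′)) v≁y′))) (proj₂ Hv)))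

      -- The 2 stands for `v` itself and the single possible neighbour outside N[v]. Hence valency
      -- at most 2 means degree at most 4, and valency at most 1 means degree at most 3.
      deg-inside : ∀ i → deg (g i) ≤ 2 + valency M i
      deg-inside i = begin
        deg (g i)                                         ≤⟨ count-cover (N? (g i)) (v Fin.≟_) rest? split ⟩
        count (v Fin.≟_) + count rest?
          ≤⟨ +-mono-≤ (≤-reflexive (count-≟ v)) (count-cover rest? (common? (g i)) (outside? (g i)) id) ⟩
        1 + (count (common? (g i)) + count (outside? (g i))) ≤⟨ +-monoʳ-≤ 1 (+-mono-≤ (≤-reflexive (codegree i)) (outside≤1 i)) ⟩
        1 + (valency M i + 1)                             ≡⟨ cong suc (+-comm (valency M i) 1) ⟩
        2 + valency M i                                   ∎
        where
        open ≤-Reasoning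
        rest? : ∀ y → Dec ((N v y × g i ~ y) ⊎ (N (g i) y × v ≢ y × ¬ v ~ y))
        rest? y = common? (g i) y ⊎-dec outside? (g i) y
        split : ∀ {y} → N (g i) y → v ≡ y ⊎ ((N v y × g i ~ y) ⊎ (N (g i) y × v ≢ y × ¬ v ~ y))
        split {y} p@(Sy , x~y) with v Fin.≟ y | T? (adj v y)
        ... | yes e | _      = inj₁ e
        ... | no _  | yes vy = inj₂ (inj₁ ((Sy , vy) , x~y))
        ... | no ¬e | no ¬vy = inj₂ (inj₂ (p , ¬e , ¬vy))

      small-low : ∀ {i} → valency M i ≤ 2 → Low (g i)
      small-low {i} ≤2 = proj₁ (g-N i) , ≤-trans (deg-inside i) (+-monoʳ-≤ 2 ≤2)

      -- The hub has all its neighbours in N[v], so a vertex of degree 5 outside N[v] would miss both v and the hub.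
      small-#high : HasHub M → ∀ {i} → valency M i ≤ 2 → #high (g i) ≤ 3
      small-#high (c , 4≤ , spokes) {i} ≤2 = begin
        #high (g i)                                 ≤⟨ count-cover (highNeighbour? (g i)) (v Fin.≟_) (common? (g i)) split ⟩
        count (v Fin.≟_) + count (common? (g i))    ≤⟨ +-mono-≤ (≤-reflexive (count-≟ v)) (≤-reflexive (codegree i)) ⟩
        1 + valency M i                             ≤⟨ +-monoʳ-≤ 1 ≤2 ⟩
        3                                           ∎
        where
        open ≤-Reasoning
        h : Fin n
        h = g c
        v~h : v ~ h
        v~h = proj₂ (g-N c)
        hub-full : ∀ {y} → T (S y) → v ≢ y → ¬ v ~ y → ¬ (h ~ y)
        hub-full {y} Sy v≢y v≁y h~y = <⇒≱ (begin-strict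
          5                                                             <⟨ +-monoʳ-≤ 1 (+-monoˡ-≤ 1 4≤) ⟩
          1 + (valency M c + 1)
            ≡⟨ cong₂ _+_ (sym (count-≟ v)) (cong₂ _+_ (sym (codegree c)) (sym (count-≟ y))) ⟩
          count (v Fin.≟_) + (count (common? h) + count (y Fin.≟_))
            ≤⟨ +-monoʳ-≤ (count (v Fin.≟_)) (count-disjoint (common? h) (y Fin.≟_) new? inj₁ inj₂ λ { ((_ , v~z) , _) refl → v≁y v~z }) ⟩
          count (v Fin.≟_) + count new?                                 ≤⟨ count-disjoint (v Fin.≟_) new? (N? h)
              (λ { refl → proj₁ Hv , ~-sym v~h })
              (λ { (inj₁ ((Sz , _) , h~z)) → Sz , h~z ; (inj₂ refl) → Sy , h~y })
              (λ { refl (inj₁ ((_ , v~v) , _)) → ~-irrefl v~v ; refl (inj₂ y≡v) → v≢y (sym y≡v) }) ⟩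
          deg h                                                         ∎) (max (proj₁ (g-N c)))
          where
          new? : ∀ z → Dec ((N v z × h ~ z) ⊎ y ≡ z)
          new? z = common? h z ⊎-dec (y Fin.≟ z)
        impossible : ∀ {y} → High y → g i ~ y → v ≢ y → ¬ v ~ y → ⊥
        impossible {y} (Sy , 5≤) x~y v≢y v≁y = <⇒≱ (s≤s (deg-bound (~-sym x~y) (~-sym (proj₂ (g-N i))) (~-sym (M-~ (spokes i ≤2)))
            (~⇒≢ v~h) v≢y (λ { refl → v≁y v~h })))
          (subst (λ k → suc (4 + k) ≤ deg y) (sym (cong₂ _+_ (𝟙-no (T? (adj y v)) (v≁y ∘ ~-sym))
            (𝟙-no (T? (adj y h)) (hub-full Sy v≢y v≁y ∘ ~-sym)))) 5≤)
        split : ∀ {y} → High y × g i ~ y → v ≡ y ⊎ (N v y × g i ~ y)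
        split {y} (Hy , x~y) with v Fin.≟ y | T? (adj v y)
        ... | yes e | _      = inj₁ e
        ... | no _  | yes vy = inj₂ ((proj₁ Hy , vy) , x~y)
        ... | no ¬e | no ¬vy = ⊥-elim (impossible Hy x~y ¬e ¬vy)

      from-small : ∀ r → (∀ {i} → valency M i ≤ 2 → r ≤ give (g i)) → count (small? M) * r ≤ received v
      from-small r r≤ = begin
        count (small? M) * r                        ≡⟨ *-distribʳ-sum r (λ i → 𝟙 (small? M i)) ⟩
        (sum λ i → 𝟙 (small? M i) * r)              ≤⟨ sum-mono term ⟩
        (sum λ i → 𝟙 (low? (g i)) * give (g i))     ≡⟨ sym received-sum ⟩
        received v                                  ∎
        where
        open ≤-Reasoning
        term : ∀ i → 𝟙 (small? M i) * r ≤ 𝟙 (low? (g i)) * give (g i)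
        term i = by (small? M i)
          where
          by : (p : Dec (valency M i ≤ 2)) → 𝟙 p * r ≤ 𝟙 (low? (g i)) * give (g i)
          by (yes p) = *-mono-≤ (≤-reflexive (sym (𝟙-yes (low? (g i)) (small-low p)))) (r≤ p)
          by (no _)  = z≤n

      -- The three shapes pay 8 from one neighbour of degree at most 3, or 3 + 3 + 3 from three low
      -- neighbours, or 4 + 4 from two neighbours tied to a hub.
      8≤received : 8 ≤ received v
      8≤received = by shape
        where
        open ≤-Reasoning
        by : (∃ λ i → valency M i ≤ 1) ⊎ 3 ≤ count (small? M) ⊎ (2 ≤ count (small? M) × HasHub M) → 8 ≤ received v
        by (inj₁ (i , ≤1)) = begin
          1 * 8
            ≤⟨ *-mono-≤ (≤-reflexive (sym (𝟙-yes (low? (g i)) (small-low (≤-trans ≤1 (n≤1+n 1)))))) (8≤give (≤-trans (deg-inside i) (+-monoʳ-≤ 2 ≤1))) ⟩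
          𝟙 (low? (g i)) * give (g i)              ≤⟨ term≤sum (λ i → 𝟙 (low? (g i)) * give (g i)) i ⟩
          (sum λ i → 𝟙 (low? (g i)) * give (g i))  ≡⟨ sym received-sum ⟩
          received v                               ∎
        by (inj₂ (inj₁ 3≤)) = ≤-trans (≤-trans (n≤1+n 8) (*-monoˡ-≤ 3 3≤)) (from-small 3 λ _ → 3≤give _)
        by (inj₂ (inj₂ (2≤ , hub))) = ≤-trans (*-monoˡ-≤ 4 2≤) (from-small 4 λ p → 4≤give (small-#high hub p))

    high-receives : ∀ {v} → High v → 8 ≤ received v
    high-receives {v} Hv = at (≤-antisym (max (proj₁ Hv)) (proj₂ Hv))
      where
      at : deg v ≡ 5 → 8 ≤ received v
      at eq = let g , g-inj , g-N , onto = enumerate-as (N? v) eq in AtHigh.8≤received Hv g g-inj g-N onto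

    -- The charge moving along pairs of a high `v` and a low `x` is summed first by receivers, then
    -- by givers.
    conservation : 8 * count high? ≤ sum out
    conservation = begin
      8 * count high?                                                            ≡⟨ *-distribˡ-sum 8 (λ v → 𝟙 (high? v)) ⟩
      (sum λ v → 8 * 𝟙 (high? v))                                                ≤⟨ sum-mono (λ v → supply v (high? v)) ⟩
      (sum λ v → 𝟙 (high? v) * received v)
        ≡⟨ sum-cong-≗ (λ v → *-distribˡ-sum (𝟙 (high? v)) (λ x → 𝟙 (lowNeighbour? v x) * give x)) ⟩
      (sum λ v → sum λ x → 𝟙 (high? v) * (𝟙 (lowNeighbour? v x) * give x))       ≤⟨ sum-mono (λ v → sum-mono (λ x → swap v x)) ⟩
      (sum λ v → sum λ x → 𝟙 (highNeighbour? x v) * (𝟙 (low? x) * give x))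
        ≡⟨ ∑-comm (λ v x → 𝟙 (highNeighbour? x v) * (𝟙 (low? x) * give x)) ⟩
      (sum λ x → sum λ v → 𝟙 (highNeighbour? x v) * (𝟙 (low? x) * give x))
        ≡⟨ sum-cong-≗ (λ x → sym (*-distribʳ-sum (𝟙 (low? x) * give x) (λ v → 𝟙 (highNeighbour? x v)))) ⟩
      sum out                                                                    ∎
      where
      open ≤-Reasoning
      supply : ∀ v (p : Dec (High v)) → 8 * 𝟙 p ≤ 𝟙 p * received v
      supply v (yes Hv) = ≤-trans (high-receives Hv) (≤-reflexive (sym (*-identityˡ (received v))))
      supply v (no _)   = z≤n
      swap : ∀ v x → 𝟙 (high? v) * (𝟙 (lowNeighbour? v x) * give x) ≤ 𝟙 (highNeighbour? x v) * (𝟙 (low? x) * give x)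
      swap v x = begin
        𝟙 (high? v) * (𝟙 (lowNeighbour? v x) * give x)        ≡⟨ sym (*-assoc (𝟙 (high? v)) _ _) ⟩
        𝟙 (high? v) * 𝟙 (lowNeighbour? v x) * give x          ≡⟨ cong (_* give x) (sym (𝟙-× (high? v) (lowNeighbour? v x))) ⟩
        𝟙 (high? v ×-dec lowNeighbour? v x) * give x
          ≤⟨ *-monoˡ-≤ (give x) (𝟙-mono (high? v ×-dec lowNeighbour? v x) (highNeighbour? x v ×-dec low? x)
                                                                 λ { (Hv , (_ , v~x) , Lx) → (Hv , ~-sym v~x) , Lx }) ⟩
        𝟙 (highNeighbour? x v ×-dec low? x) * give x          ≡⟨ cong (_* give x) (𝟙-× (highNeighbour? x v) (low? x)) ⟩
        𝟙 (highNeighbour? x v) * 𝟙 (low? x) * give x          ≡⟨ *-assoc (𝟙 (highNeighbour? x v)) _ _ ⟩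
        𝟙 (highNeighbour? x v) * (𝟙 (low? x) * give x)        ∎

    -- A low vertex stays within 92 by `give-cap`. A vertex of degree 5 has charge 100 = 92 + 8 and
    -- hands out nothing.
    balance : ∀ u → 20 * count (arc? u) + out u ≤ 92 * 𝟙 (T? (S u)) + 8 * 𝟙 (high? u)
    balance u = by (T? (S u)) (deg u ≤? 4)
      where
      open ≤-Reasoning
      out-zero : ¬ Low u → out u ≡ 0
      out-zero ¬L = trans (cong (λ k → #high u * (k * give u)) (𝟙-no (low? u) ¬L)) (*-zeroʳ (#high u))
      arcs≤deg : count (arc? u) ≤ deg u
      arcs≤deg = count-mono (arc? u) (N? u) proj₂
      by : Dec (T (S u)) → Dec (deg u ≤ 4) → 20 * count (arc? u) + out u ≤ 92 * 𝟙 (T? (S u)) + 8 * 𝟙 (high? u)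
      by (no ¬S) _ = ≤-trans (≤-reflexive (cong₂ _+_ (cong (20 *_) (count≡0 (arc? u) λ _ → ¬S ∘ proj₁)) (out-zero (¬S ∘ proj₁)))) z≤n
      by (yes Su) (yes ≤4) = begin
        20 * count (arc? u) + out u
          ≤⟨ +-mono-≤ (*-monoʳ-≤ 20 arcs≤deg) (*-monoʳ-≤ (#high u) (≤-trans (*-monoˡ-≤ (give u) (𝟙≤1 (low? u))) (≤-reflexive (*-identityˡ (give u))))) ⟩
        20 * deg u + #high u * give u                   ≤⟨ give-cap ≤4 ⟩
        92 * 1                                          ≡⟨ cong (92 *_) (sym (𝟙-yes (T? (S u)) Su)) ⟩
        92 * 𝟙 (T? (S u))                               ≤⟨ m≤m+n _ _ ⟩
        92 * 𝟙 (T? (S u)) + 8 * 𝟙 (high? u)             ∎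
      by (yes Su) (no ¬≤4) = begin
        20 * count (arc? u) + out u
          ≤⟨ +-mono-≤ (*-monoʳ-≤ 20 (≤-trans arcs≤deg (max Su))) (≤-reflexive (out-zero (¬≤4 ∘ proj₂))) ⟩
        92 * 1 + 8 * 1
          ≡⟨ cong₂ (λ a b → 92 * a + 8 * b) (sym (𝟙-yes (T? (S u)) Su)) (sym (𝟙-yes (high? u) (Su , ≰⇒> ¬≤4))) ⟩
        92 * 𝟙 (T? (S u)) + 8 * 𝟙 (high? u)             ∎

    discharged : 5 * arcs ≤ 23 * size
    discharged = *-cancelˡ-≤ 4 (+-cancelʳ-≤ (sum out) _ _ (begin
      4 * (5 * arcs) + sum out
        ≡⟨ cong (_+ sum out) (trans (sym (*-assoc 4 5 arcs)) (*-distribˡ-sum 20 (λ u → count (arc? u)))) ⟩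
      (sum λ u → 20 * count (arc? u)) + sum out                         ≡⟨ sym (∑-distrib-+ (λ u → 20 * count (arc? u)) out) ⟩
      (sum λ u → 20 * count (arc? u) + out u)                           ≤⟨ sum-mono balance ⟩
      (sum λ u → 92 * 𝟙 (T? (S u)) + 8 * 𝟙 (high? u))                   ≡⟨ ∑-distrib-+ (λ u → 92 * 𝟙 (T? (S u))) (λ u → 8 * 𝟙 (high? u)) ⟩
      (sum λ u → 92 * 𝟙 (T? (S u))) + (sum λ u → 8 * 𝟙 (high? u))
        ≡⟨ cong₂ _+_ (trans (sym (*-distribˡ-sum 92 (λ u → 𝟙 (T? (S u))))) (*-assoc 4 23 size)) (sym (*-distribˡ-sum 8 (λ u → 𝟙 (high? u)))) ⟩
      4 * (23 * size) + 8 * count high?                                 ≤⟨ +-monoʳ-≤ (4 * (23 * size)) conservation ⟩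
      4 * (23 * size) + sum out                                         ∎))
      where open ≤-Reasoning

  -- Induction over the set of remaining vertices

  module Bounded {n} {G : Graph n} (planar : Planar G) (free : ¬ Contains (doubleStar 2 4) G) where
    open Graph G
    open Main planar free
    open Within

    dichotomy : ∀ S → Reducible S ⊎ 5 * arcs S ≤ 23 * size S
    dichotomy S with any? (λ u → T? (S u) ×-dec (deg S u ≤? 2)) | any? (λ u → T? (S u) ×-dec (6 ≤? deg S u))
    ... | yes (_ , Su , ≤2) | _ = inj₁ (remove-small S Su ≤2)
    ... | no ¬small | yes (_ , Sv , 6≤) = inj₁ (remove-large S Sv (λ Su → ≰⇒> λ ≤2 → ¬small (_ , Su , ≤2)) 6≤)
    ... | no _ | no ¬large = inj₂ (Discharge.discharged planar free S λ Su → s≤s⁻¹ (≰⇒> λ 6≤ → ¬large (_ , Su , 6≤)))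

    arcs-bound : ∀ m S → size S ≤ m → 5 * arcs S ≤ 23 * size S
    arcs-bound m S size≤ with dichotomy S
    ... | inj₂ bound = bound
    arcs-bound zero    S size≤ | inj₁ (S′ , smaller , _) = ⊥-elim (n≮0 (<-≤-trans smaller size≤))
    arcs-bound (suc m) S size≤ | inj₁ (S′ , smaller , step) = +-cancelʳ-≤ (23 * size S′) _ _
      (≤-trans step (≤-trans (+-monoˡ-≤ (23 * size S) (arcs-bound m S′ (s≤s⁻¹ (<-≤-trans smaller size≤))))
                             (≤-reflexive (+-comm (23 * size S′) (23 * size S)))))

    edge-bound : 10 * edgeCount ≤ 23 * n
    edge-bound = begin
      10 * edgeCount                      ≡⟨ *-assoc 5 2 edgeCount ⟩
      5 * (2 * edgeCount)                 ≤⟨ *-monoʳ-≤ 5 2*edgeCount≤degreeSum ⟩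
      5 * arcs (λ _ → true)               ≤⟨ arcs-bound n (λ _ → true) (≤-reflexive all) ⟩
      23 * size (λ _ → true)              ≡⟨ cong (23 *_) all ⟩
      23 * n                              ∎
      where
      open ≤-Reasoning
      open Darts G using (2*edgeCount≤degreeSum)
      all : size (λ _ → true) ≡ n
      all = count-all (λ u → T? true) λ _ → tt

-- From 23n/10 to 17n/7 - 2

open import Data.Integer using (+_)
import Data.Integer as ℤ
import Data.Integer.Properties as ℤ
open import Data.Nat using (ℕ; suc; _≥_)
import Data.Nat as ℕ
import Data.Nat.Properties as ℕ
open import Data.Product using (_,_)
open import Data.Rational using (_/_; _*_; _-_; _≤_; toℚᵘ) renaming (-_ to ℚ-neg)
import Data.Rational.Properties as ℚ
open import Data.Rational.Unnormalised using (mkℚᵘ; *≤*)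
import Data.Rational.Unnormalised as ℚᵘ
import Data.Rational.Unnormalised.Properties as ℚᵘ
open import Data.Sum using (inj₁; inj₂)
open import Relation.Binary.PropositionalEquality using (_≡_; refl; sym; trans; cong)
open import Relation.Nullary.Decidable using (from-yes)

scaled-bound-≥16 : ∀ e n → n ≥ 16 → 10 ℕ.* e ℕ.≤ 23 ℕ.* n → 7 ℕ.* e ℕ.+ 14 ℕ.≤ 17 ℕ.* n
scaled-bound-≥16 e n n≥16 h = ℕ.*-cancelˡ-≤ 10 (begin
  10 ℕ.* (7 ℕ.* e ℕ.+ 14)           ≡⟨ ℕ.*-distribˡ-+ 10 (7 ℕ.* e) 14 ⟩
  10 ℕ.* (7 ℕ.* e) ℕ.+ 140          ≡⟨ cong (ℕ._+ 140) (trans (sym (ℕ.*-assoc 10 7 e)) (ℕ.*-assoc 7 10 e)) ⟩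
  -- The two slopes differ by 9/70, so the constant 2 is absorbed once 9n ≥ 140; 16 is the first
  -- such n, with 9 · 16 = 140 + 4.
  7 ℕ.* (10 ℕ.* e) ℕ.+ 140          ≤⟨ ℕ.+-mono-≤ (ℕ.*-monoʳ-≤ 7 h) (ℕ.≤-trans (ℕ.m≤m+n 140 4) (ℕ.*-monoʳ-≤ 9 n≥16)) ⟩
  7 ℕ.* (23 ℕ.* n) ℕ.+ 9 ℕ.* n      ≡⟨ cong (ℕ._+ 9 ℕ.* n) (sym (ℕ.*-assoc 7 23 n)) ⟩
  161 ℕ.* n ℕ.+ 9 ℕ.* n             ≡⟨ sym (ℕ.*-distribʳ-+ n 161 9) ⟩
  170 ℕ.* n                         ≡⟨ ℕ.*-assoc 10 17 n ⟩
  10 ℕ.* (17 ℕ.* n)                 ∎)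
  where open ℕ.≤-Reasoning

-- `k` is at least the integer part of 23n/10, hence `e ≤ k`, and it is enough to check the claim
-- for `k`.
rounded : ∀ k n e → 10 ℕ.* e ℕ.≤ 23 ℕ.* n → 23 ℕ.* n ℕ.< 10 ℕ.* suc k → 7 ℕ.* k ℕ.+ 14 ℕ.≤ 17 ℕ.* n →
  7 ℕ.* e ℕ.+ 14 ℕ.≤ 17 ℕ.* n
rounded k n e h h′ h″ = ℕ.≤-trans (ℕ.+-monoˡ-≤ 14 (ℕ.*-monoʳ-≤ 7 (ℕ.s≤s⁻¹ (ℕ.*-cancelˡ-< 10 e (suc k) (ℕ.≤-<-trans h h′))))) h″

-- For 12 ≤ n ≤ 15 the bound 10 e ≤ 23 n suffices only because e is an integer.
scaled-bound : ∀ e n → n ≥ 12 → 10 ℕ.* e ℕ.≤ 23 ℕ.* n → 7 ℕ.* e ℕ.+ 14 ℕ.≤ 17 ℕ.* n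
scaled-bound e n n≥12 h with ℕ.m≤n⇒m<n∨m≡n n≥12
... | inj₂ refl = rounded 27 12 e h (from-yes (276 ℕ.<? 280)) (from-yes (203 ℕ.≤? 204))
... | inj₁ n≥13 with ℕ.m≤n⇒m<n∨m≡n n≥13
...   | inj₂ refl = rounded 29 13 e h (from-yes (299 ℕ.<? 300)) (from-yes (217 ℕ.≤? 221))
...   | inj₁ n≥14 with ℕ.m≤n⇒m<n∨m≡n n≥14
-- There is no slack here: 7 · 32 + 14 = 17 · 14.
...     | inj₂ refl = rounded 32 14 e h (from-yes (322 ℕ.<? 330)) (from-yes (238 ℕ.≤? 238))
...     | inj₁ n≥15 with ℕ.m≤n⇒m<n∨m≡n n≥15
...       | inj₂ refl = rounded 34 15 e h (from-yes (345 ℕ.<? 350)) (from-yes (252 ℕ.≤? 255))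
...       | inj₁ n≥16 = scaled-bound-≥16 e n n≥16 h

-- Among unnormalised rationals the denominators 1 and 7 stay explicit, so the claim becomes an
-- inequality of integers by cross-multiplication.
rational-bound : ∀ e n → 7 ℕ.* e ℕ.+ 14 ℕ.≤ 17 ℕ.* n → + e / 1 ≤ (+ 17 / 7) * (+ n / 1) - + 2 / 1
rational-bound e n h = ℚ.toℚᵘ-cancel-≤ (begin
  toℚᵘ (+ e / 1)                                             ≃⟨ ℚ.toℚᵘ-fromℚᵘ (mkℚᵘ (+ e) 0) ⟩
  mkℚᵘ (+ e) 0                                               ≤⟨ *≤* integral ⟩
  mkℚᵘ (+ 17) 6 ℚᵘ.* mkℚᵘ (+ n) 0 ℚᵘ.- mkℚᵘ (+ 2) 0
    ≃⟨ ℚᵘ.+-cong (ℚᵘ.*-cong (ℚᵘ.≃-sym (ℚ.toℚᵘ-fromℚᵘ (mkℚᵘ (+ 17) 6))) (ℚᵘ.≃-sym (ℚ.toℚᵘ-fromℚᵘ (mkℚᵘ (+ n) 0)))) ℚᵘ.≃-refl ⟩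
  toℚᵘ (+ 17 / 7) ℚᵘ.* toℚᵘ (+ n / 1) ℚᵘ.+ toℚᵘ (ℚ-neg (+ 2 / 1)) ≃⟨ ℚᵘ.+-congˡ _ (ℚᵘ.≃-sym (ℚ.toℚᵘ-homo-* (+ 17 / 7) (+ n / 1))) ⟩
  toℚᵘ ((+ 17 / 7) * (+ n / 1)) ℚᵘ.+ toℚᵘ (ℚ-neg (+ 2 / 1))  ≃⟨ ℚᵘ.≃-sym (ℚ.toℚᵘ-homo-+ ((+ 17 / 7) * (+ n / 1)) (ℚ-neg (+ 2 / 1))) ⟩
  toℚᵘ ((+ 17 / 7) * (+ n / 1) - + 2 / 1)                    ∎)
  where
  open ℚᵘ.≤-Reasoning
  -- The cross-multiplied form of 7e ≤ 17n - 14, with the trivial factors 1 that unnormalised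
  -- arithmetic leaves behind.
  integral : + e ℤ.* + 7 ℤ.≤ (+ 17 ℤ.* + n ℤ.* + 1 ℤ.+ ℤ.- + 14) ℤ.* + 1
  integral = ℤ.≤-trans (ℤ.≤-reflexive (trans (sym (ℤ.pos-* e 7)) shifted))
    (ℤ.≤-trans (ℤ.+-monoˡ-≤ (ℤ.- + 14) (ℤ.+≤+ h)) (ℤ.≤-reflexive
      (trans (cong (ℤ._+ ℤ.- + 14) (trans (ℤ.pos-* 17 n) (sym (ℤ.*-identityʳ (+ 17 ℤ.* + n)))))
             (sym (ℤ.*-identityʳ (+ 17 ℤ.* + n ℤ.* + 1 ℤ.+ ℤ.- + 14))))))
    where
    shifted : + (e ℕ.* 7) ≡ + (7 ℕ.* e ℕ.+ 14) ℤ.+ ℤ.- + 14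
    shifted = sym (trans (ℤ.m-n≡m⊖n (7 ℕ.* e ℕ.+ 14) 14) (trans (ℤ.⊖-≥ (ℕ.m≤n+m 14 (7 ℕ.* e)))
      (cong +_ (trans (ℕ.m+n∸n≡m (7 ℕ.* e) 14) (ℕ.*-comm 7 e)))))

theorem1p1 : ∀ (n : ℕ) → n ≥ 12 →
    ∀ (ex : ℕ) → IsPlanarTuránNumber n (doubleStar 2 4) ex →
    + ex / 1 ≤ (+ 17 / 7) * (+ n / 1) - + 2 / 1
theorem1p1 n n≥12 ex ((G , planar , free , refl) , _) =
  rational-bound ex n (scaled-bound ex n n≥12 (EdgeBound.Bounded.edge-bound planar free))
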